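{- Let $m\ge 4$ and $n\ge 5$ be integers. Consider the king-and-rook versus king chess endgame on an $m\times n$ board in which White has a king on $(m,1)$ and a rook on $(1,1)$, Black has a lone king on $(m,n)$, and it is White to move. Let $FM(m,n)$ be the smallest number $k$ such that White can force checkmate in at most $k$ moves against every defence by Black. Then $$FM(m,n)=\begin{cases} n & \text{if } n \text{ is odd},\\ n+1 & \text{if } n \text{ is even}.\end{cases}$$
   Context: The board consists of the squares $(i,j)$ with $1\le i\le m$ (column index) and $1\le j\le n$ (row index). Pieces move according to the usual chess rules adapted to this board: a king moves to any of the (up to eight) adjacent squares, a rook moves any number of squares along its row or column without passing over other pieces, kings may not move into check, and two kings may never be on adjacent squares. Checkmate means Black's king is attacked and Black has no legal move. The number of moves counted is the number of White moves, including the mating move. -}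

module Defs where

open import Data.Nat using (ℕ; zero; suc; _≤_; _<_; ∣_-_∣)
open import Data.Product using (_×_; Σ; _,_; proj₁; proj₂; ∃)
open import Data.Sum using (_⊎_)
open import Data.Maybe using (Maybe; just; nothing)
open import Data.Empty using (⊥)
open import Relation.Binary.PropositionalEquality using (_≡_; _≢_)
open import Relation.Nullary using (¬_)

Sq : Set
Sq = ℕ × ℕ

col row : Sq → ℕ
col = proj₁
row = proj₂

OnBoard : ℕ → ℕ → Sq → Set
OnBoard m n s = (1 ≤ col s × col s ≤ m) × (1 ≤ row s × row s ≤ n)

Adjacent : Sq → Sq → Set
Adjacent a b = a ≢ b × ∣ col a - col b ∣ ≤ 1 × ∣ row a - row b ∣ ≤ 1

Btw : ℕ → ℕ → ℕ → Set
Btw x y z = (x < y × y < z) ⊎ (z < y × y < x)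

Line : Sq → Sq → Set
Line a b = a ≢ b × (col a ≡ col b ⊎ row a ≡ row b)

StrictlyBetween : Sq → Sq → Sq → Set
StrictlyBetween a c b =
    (col a ≡ col b × col c ≡ col a × Btw (row a) (row c) (row b))
  ⊎ (row a ≡ row b × row c ≡ row a × Btw (col a) (col c) (col b))

-- Position: White king, White rook (nothing = captured), Black king.
record Pos : Set where
  constructor pos
  field
    wk : Sq
    wr : Maybe Sq
    bk : Sq
open Pos public

-- The rook at r attacks square s; only the White king can block
-- (the Black king never shields squares from the rook for its own moves).
RookAttacks : Pos → Sq → Set
RookAttacks p s = Σ Sq λ r → wr p ≡ just r × Line r s × ¬ StrictlyBetween r (wk p) s

InCheck : Pos → Set
InCheck p = RookAttacks p (bk p)

data WMove (m n : ℕ) : Pos → Pos → Set where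
  kingMove : ∀ {k r b s} → OnBoard m n s → Adjacent k s → s ≢ b → ¬ Adjacent s b →
             r ≢ just s → WMove m n (pos k r b) (pos s r b)
  rookMove : ∀ {k r b s} → OnBoard m n s → Line r s →
             ¬ StrictlyBetween r k s → ¬ StrictlyBetween r b s → s ≢ k → s ≢ b →
             WMove m n (pos k (just r) b) (pos k (just s) b)

data BMove (m n : ℕ) : Pos → Pos → Set where
  kingMove : ∀ {k r b s} → OnBoard m n s → Adjacent b s → s ≢ k → ¬ Adjacent s k →
             ¬ RookAttacks (pos k r b) s → r ≢ just s → BMove m n (pos k r b) (pos k r s)
  capture  : ∀ {k b s} → OnBoard m n s → Adjacent b s → s ≢ k → ¬ Adjacent s k →
             ¬ RookAttacks (pos k (just s) b) s → BMove m n (pos k (just s) b) (pos k nothing s)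

Checkmate : ℕ → ℕ → Pos → Set
Checkmate m n p = InCheck p × (∀ q → ¬ BMove m n p q)

WinIn : ℕ → ℕ → ℕ → Pos → Set
WinIn m n zero p = ⊥
WinIn m n (suc k) p =
  Σ Pos λ q → WMove m n p q ×
    (Checkmate m n q ⊎ ((∃ λ q' → BMove m n q q') × (∀ q' → BMove m n q q' → WinIn m n k q')))

start : ℕ → ℕ → Pos
start m n = pos (m , 1) (just (1 , 1)) (m , n)

IsFM : ℕ → ℕ → ℕ → Set
IsFM m n k = WinIn m n k (start m n) × (∀ k' → WinIn m n k' (start m n) → k ≤ k')

{-# OPTIONS --safe #-}
-- The white king needs n ∸ 3 moves to come within two rows of the top edge, and before that no mate on the top
-- two rows is possible; so at most a couple of White's moves are not king moves up the board.
-- Upper bound: the rook cuts the black king off on its edge column, after one waiting move if n is even; from then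
-- on the distance between the kings is odd with White to move, so White keeps the opposition and mates in the corner.
-- Lower bound: Black stays near the corner (m , n). Seen from there all far away squares look alike, up to the parity
-- of the white king's row, so that Black's strategy lives in a finite game, which is checked by evaluation for
-- boards of width 4, …, 7 and for all wider boards at once.
module Submission where

open import Defs
open import Data.Bool using (Bool; true; false; T; not) renaming (_∧_ to _and_; _∨_ to _or_)
open import Data.Empty using (⊥)
open import Data.List using (List; []; _∷_)
open import Data.Maybe using (just; nothing)
open import Data.Maybe.Properties using (just-injective)
open import Data.Nat using (ℕ; zero; suc; _+_; _∸_; _≤_; _<_; _≤ᵇ_; _<ᵇ_; _≡ᵇ_; z≤n; s≤s; _⊓_; _%_; ∣_-_∣)
open import Data.Nat.DivMod using ([m+n]%n≡m%n)
open import Data.Nat.Properties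
open import Data.Product using (_×_; _,_; proj₁; proj₂; ∃; uncurry)
open import Data.Sum using (_⊎_; inj₁; inj₂; [_,_]′)
open import Data.Vec using (Vec; []; _∷_)
open import Function using (id; _∘_)
open import Relation.Binary.PropositionalEquality
open import Relation.Nullary using (¬_; yes; no; Reflects; _because_; proof; contradiction)
open import Relation.Nullary.Decidable using (map′)
open import Relation.Nullary.Reflects using (T-reflects; ¬-reflects; _×-reflects_; _⊎-reflects_; _→-reflects_; invert)

-- The lower bound keeps account of White's surplus. With `l` moves left and the white king on row
-- `y`, let `e = l + 2 - y`. A king step towards the top edge keeps `e`, a sideways king move or a
-- rook move lowers it by one, and a king step back lowers it by two. Once `e` is 0, a black king on
-- the top two rows is safe. With one move fewer than claimed, White starts at `e = 2` for odd `n`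
-- and at `e = 3` for even `n`; the invariants `far e` are indexed by this number. When the white
-- king reaches row 5 at most 6 moves remain, so only rows 0 to 5 need tables. All rounding in the
-- coarse game favours White. Hence each comparison of the coarse game with the board is needed in
-- one direction only, and coarse survival implies real survival but not conversely. Parity enters
-- through the end of the game: with the black king in the corner and the rook on the next column, a
-- white king arriving two rows below in the same column gives stalemate instead of mate.

-- Decidable formulas

-- Two inequalities instead of a bound on `∣ a - b ∣`: in this form the relation passes directly
-- through the monotone truncation `_⊓ k` and the reflection `k ∸_`.
Close : ℕ → ℕ → Set
Close a b = a ≤ suc b × b ≤ suc a

close-sym : ∀ {a b} → Close a b → Close b a
close-sym (p , q) = q , p

close-refl : ∀ {a} → Close a a
close-refl = n≤1+n _ , n≤1+n _

close-suc : ∀ {a} → Close a (suc a)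
close-suc = m≤n⇒m≤1+n (n≤1+n _) , ≤-refl

data CloseView : ℕ → ℕ → Set where
  below : ∀ {a} → CloseView (suc a) a
  level : ∀ {a} → CloseView a a
  above : ∀ {a} → CloseView a (suc a)

closeView : ∀ {a b} → Close a b → CloseView a b
closeView {zero}  {zero}        _ = level
closeView {zero}  {suc zero}    _ = above
closeView {zero}  {suc (suc b)} (_ , s≤s ())
closeView {suc zero} {zero}     _ = below
closeView {suc (suc a)} {zero}  (s≤s () , _)
closeView {suc a} {suc b} (s≤s p , s≤s q) with closeView (p , q)
... | below = below
... | level = level
... | above = above

infix 6 ~_
infix 5 _≐_ _⊑_ _⊏_
infixr 4 _∧_
infixr 3 _∨_
infixr 2 _⇒_

-- `holds` is what gets evaluated, ⟦_⟧ what it means. Deciding ⟦_⟧ with the combinators on Dec instead would be an order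
-- of magnitude slower.
data Form : Set where
  bit           : Bool → Form
  _≐_ _⊑_ _⊏_   : ℕ → ℕ → Form
  _∧_ _∨_ _⇒_   : Form → Form → Form
  ~_            : Form → Form
  ∀<            : ℕ → (ℕ → Form) → Form
  ∀close ∃close : ℕ → (ℕ → Form) → Form

⟦_⟧ : Form → Set
⟦ bit b ⟧      = T b
⟦ a ≐ b ⟧      = a ≡ b
⟦ a ⊑ b ⟧      = a ≤ b
⟦ a ⊏ b ⟧      = a < b
⟦ φ ∧ ψ ⟧      = ⟦ φ ⟧ × ⟦ ψ ⟧
⟦ φ ∨ ψ ⟧      = ⟦ φ ⟧ ⊎ ⟦ ψ ⟧
⟦ φ ⇒ ψ ⟧      = ⟦ φ ⟧ → ⟦ ψ ⟧
⟦ ~ φ ⟧        = ¬ ⟦ φ ⟧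
⟦ ∀< n φ ⟧     = ∀ i → i < n → ⟦ φ i ⟧
⟦ ∀close a φ ⟧ = ∀ x → Close a x → ⟦ φ x ⟧
⟦ ∃close a φ ⟧ = ∃ λ x → Close a x × ⟦ φ x ⟧

all : ℕ → (ℕ → Bool) → Bool
all zero    f = true
all (suc n) f = f n and all n f

holds : Form → Bool
holds (bit b)            = b
holds (a ≐ b)            = a ≡ᵇ b
holds (a ⊑ b)            = a ≤ᵇ b
holds (a ⊏ b)            = a <ᵇ b
holds (φ ∧ ψ)            = holds φ and holds ψ
holds (φ ∨ ψ)            = holds φ or holds ψ
holds (φ ⇒ ψ)            = not (holds φ) or holds ψ
holds (~ φ)              = not (holds φ)
holds (∀< n φ)           = all n (λ i → holds (φ i))
holds (∀close zero φ)    = holds (φ 0) and holds (φ 1)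
holds (∀close (suc a) φ) = holds (φ a) and holds (φ (suc a)) and holds (φ (suc (suc a)))
holds (∃close zero φ)    = holds (φ 0) or holds (φ 1)
holds (∃close (suc a) φ) = holds (φ a) or holds (φ (suc a)) or holds (φ (suc (suc a)))

module _ {P : ℕ → Set} where

  all-reflects : ∀ {f} → (∀ i → Reflects (P i) (f i)) → ∀ n → Reflects (∀ i → i < n → P i) (all n f)
  all-reflects r zero    = proof (yes λ _ ())
  all-reflects r (suc n) = proof (map′ to from (_ because (r n ×-reflects all-reflects r n)))
    where
    to : P n × (∀ i → i < n → P i) → ∀ i → i < suc n → P i
    to (p , ps) i i≤n with m≤n⇒m<n∨m≡n (≤-pred i≤n)
    ... | inj₁ i<n  = ps i i<n
    ... | inj₂ refl = p
    from : (∀ i → i < suc n → P i) → P n × (∀ i → i < n → P i)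
    from ps = ps n ≤-refl , λ i i<n → ps i (m≤n⇒m≤1+n i<n)

  ∀close-0 : P 0 × P 1 → ∀ x → Close 0 x → P x
  ∀close-0 (p , q) x c with closeView c
  ... | level = p
  ... | above = q

  ∀close-suc : ∀ {a} → P a × P (suc a) × P (suc (suc a)) → ∀ x → Close (suc a) x → P x
  ∀close-suc (p , q , r) x c with closeView c
  ... | below = p
  ... | level = q
  ... | above = r

  ∃close-0 : (∃ λ x → Close 0 x × P x) → P 0 ⊎ P 1
  ∃close-0 (x , c , p) with closeView c
  ... | level = inj₁ p
  ... | above = inj₂ p

  ∃close-suc : ∀ {a} → (∃ λ x → Close (suc a) x × P x) → P a ⊎ P (suc a) ⊎ P (suc (suc a))
  ∃close-suc (x , c , p) with closeView c
  ... | below = inj₁ p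
  ... | level = inj₂ (inj₁ p)
  ... | above = inj₂ (inj₂ p)

reflects : ∀ φ → Reflects ⟦ φ ⟧ (holds φ)
reflects (bit b)  = T-reflects b
reflects (a ≐ b)  = proof (a ≟ b)
reflects (a ⊑ b)  = proof (a ≤? b)
reflects (a ⊏ b)  = proof (a <? b)
reflects (φ ∧ ψ)  = reflects φ ×-reflects reflects ψ
reflects (φ ∨ ψ)  = reflects φ ⊎-reflects reflects ψ
reflects (φ ⇒ ψ)  = reflects φ →-reflects reflects ψ
reflects (~ φ)    = ¬-reflects (reflects φ)
reflects (∀< n φ) = all-reflects (λ i → reflects (φ i)) n
reflects (∀close zero φ) = proof (map′ ∀close-0 (λ h → h 0 close-refl , h 1 close-suc)
  (_ because (reflects (φ 0) ×-reflects reflects (φ 1))))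
reflects (∀close (suc a) φ) = proof (map′ ∀close-suc
  (λ h → h a (close-sym close-suc) , h (suc a) close-refl , h (suc (suc a)) close-suc)
  (_ because (reflects (φ a) ×-reflects reflects (φ (suc a)) ×-reflects reflects (φ (suc (suc a))))))
reflects (∃close zero φ) = proof (map′ [ (λ p → 0 , close-refl , p) , (λ p → 1 , close-suc , p) ]′ ∃close-0
  (_ because (reflects (φ 0) ⊎-reflects reflects (φ 1))))
reflects (∃close (suc a) φ) = proof (map′
  [ (λ p → a , close-sym close-suc , p) , [ (λ p → suc a , close-refl , p) , (λ p → suc (suc a) , close-suc , p) ]′ ]′
  ∃close-suc
  (_ because (reflects (φ a) ⊎-reflects reflects (φ (suc a)) ⊎-reflects reflects (φ (suc (suc a))))))

sound : ∀ φ → T (holds φ) → ⟦ φ ⟧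
sound φ h with holds φ | reflects φ
... | true | r = invert r

certify : ∀ φ → holds φ ≡ true → ⟦ φ ⟧
certify φ h = sound φ (subst T (sym h) _)

-- Tables of Boolean functions

Table : ℕ → Set
Table zero    = Bool
Table (suc d) = List (Table d)

Fun : ℕ → Set
Fun zero    = Bool
Fun (suc d) = ℕ → Fun d

tabulate : ∀ {d} → Vec ℕ d → Fun d → Table d
tabulate []             b = b
tabulate (zero  ∷ ns) f = []
tabulate (suc n ∷ ns) f = tabulate ns (f 0) ∷ tabulate (n ∷ ns) (λ i → f (suc i))

lookup : ∀ {d} → Table d → Vec ℕ d → Bool
lookup b        []           = b
-- Out of range nothing is claimed for Black, so `lookup-tabulate` needs no bounds on the indices.
lookup []       (i ∷ is)     = false
lookup (t ∷ ts) (zero ∷ is)  = lookup t is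
lookup (t ∷ ts) (suc i ∷ is) = lookup ts (i ∷ is)

apply : ∀ {d} → Fun d → Vec ℕ d → Bool
apply b []       = b
apply f (i ∷ is) = apply (f i) is

lookup-tabulate : ∀ {d} ns (f : Fun d) is → T (lookup (tabulate ns f) is) → T (apply f is)
lookup-tabulate []           f []           h = h
lookup-tabulate (suc n ∷ ns) f (zero ∷ is)  h = lookup-tabulate ns (f 0) is h
lookup-tabulate (suc n ∷ ns) f (suc i ∷ is) h = lookup-tabulate (n ∷ ns) (λ i → f (suc i)) (i ∷ is) h

-- The coarse game

-- Squares of the coarse game are classes of squares (column , row), counted from 0 at the corner (m , n). There are M
-- columns, 7 standing for all columns ≥ 7. For the white king w the rows 6 and 7 stand for all even and all odd rows ≥ 6;
-- for the rook r row 4 stands for all rows ≥ 4 except the bottom row, which is 5. The black king b keeps to columns < 7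
-- and rows < 4. White may do more than in the real game (pass, jump over pieces) and Black less.
Placement : Set
Placement = (w r b : Sq) → Form

same near : Sq → Sq → Form
same a b = col a ≐ col b ∧ row a ≐ row b
near a b = (col a ⊑ suc (col b) ∧ col b ⊑ suc (col a)) ∧ (row a ⊑ suc (row b) ∧ row b ⊑ suc (row a))

parity : ℕ → ℕ
parity 0             = 0
parity 1             = 1
parity (suc (suc n)) = parity n

module Coarse (M : ℕ) where

  -- Where classes leave doubt, `attacks` holds and the others fail. The white king shields only
  -- along a column and from below; comparing its row with the rook's is decisive because class 4
  -- means at least 4 and class 5 the bottom row. `stalemated` describes a black king in a top
  -- corner, the white king two rows below it and the rook on the next column; the second corner
  -- counts only if no columns are merged.
  shielded attacks capturable stalemated : Placement
  shielded w r b = col w ≐ col r ∧ row b ⊏ row w ∧ (row w ⊑ row r ∨ row r ≐ 5)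
  attacks w r b = col r ≐ col b ∧ ~ shielded w r b ∨ row r ≐ row b
  capturable w r b = (col r ⊏ 7 ∧ row r ⊏ 4) ∧ near r b ∧ ~ near w r
  stalemated w r b = (row b ≐ 0 ∧ row w ≐ 2 ∧ 2 ⊑ row r) ∧ col w ≐ col b ∧
    (col b ≐ 0 ∧ col r ≐ 1 ∨ M ⊏ 8 ∧ suc (col b) ≐ M ∧ suc (col r) ≐ col b)

  legal : Placement → Placement
  legal good w r b = ∃close (col b) λ x → (x ⊏ M ∧ x ⊏ 7) ∧ ∃close (row b) λ y → y ⊏ 4 ∧ to (x , y)
    where
    to : Sq → Form
    to s = ~ same s b ∧ ~ same s r ∧ ~ near s w ∧ ~ attacks w r s ∧ good w r s

  -- Black, to move with k white moves to come, is not mated and can escape into a good placement if the game goes on.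
  reply : ℕ → Placement → Placement
  reply k good w r b = k ≐ 0 ∧ ~ attacks w r b ∨ capturable w r b ∨ stalemated w r b ∨ legal good w r b

  kingMoves rookMoves : (Sq → Form) → Sq → Form
  kingMoves φ w = ∀close (col w) λ x → x ⊏ M ⇒ ∀close (row w) λ y → φ (x , y)
  rookMoves φ r = ∀< M (λ x → φ (x , row r)) ∧ ∀< 6 (λ y → φ (col r , y))

  -- Placements that Black holds with White to move, l moves left and l + 2 ≡ y + e, where y ≥ 6 is the row of the white
  -- king: besides y ∸ 2 moves up and the mating move, White has e ∸ 1 moves to spare. For e ≡ 2 the rook has left its
  -- initial square at most once; in the last two cases the black king is in the corner column but has the right parity.
  far : ℕ → Placement
  far 0 w r b = row b ⊏ 2
  far 1 w r b = row b ⊏ 2 ∧ col b ⊏ 6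
  far 2 w r b = far 1 w r b ∧
    ((row r ≐ 5 ∨ suc (col r) ≐ M) ∧ (col b ≐ 1 ∨ col b ≐ 2)
     ∨ (col w ≐ 0 ∧ col b ≐ 0 ∧ row r ≐ 5) ∧
         (col r ≐ 1 ∧ row b ≐ parity (row w) ∨ suc (col r) ≐ M ∧ row b ≐ 0 ∧ parity (row w) ≐ 0))
  far (suc (suc (suc _))) w r b = far 1 w r b ∧ (row r ≐ 5 ∧ suc (col r) ≐ M) ∧
    (col b ≐ 1 ∨ col w ≐ 0 ∧ (col b ≐ 0 ∧ row b ≐ 0) ∧ parity (row w) ≐ 1)

  entry : Table 6 → Placement
  entry t w r b = bit (lookup t (col w ∷ row w ∷ col r ∷ row r ∷ col b ∷ row b ∷ []))

  table : Placement → Table 6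
  table φ = tabulate (M ∷ 6 ∷ M ∷ 6 ∷ 7 ∷ 4 ∷ []) λ wc wr rc rr bc br → holds (φ (wc , wr) (rc , rr) (bc , br))

  table-sound : ∀ φ w r b → ⟦ entry (table φ) w r b ⟧ → ⟦ φ w r b ⟧
  table-sound φ w r b h = sound (φ w r b)
    (lookup-tabulate (M ∷ 6 ∷ M ∷ 6 ∷ 7 ∷ 4 ∷ []) _ (col w ∷ row w ∷ col r ∷ row r ∷ col b ∷ row b ∷ []) h)

  -- A king leaving the tabulated rows arrives on row 6 exactly, where `k + 2 ≡ 6 + e` gives the
  -- index `k ∸ 4` of `far`.
  after : ℕ → Table 6 → Placement
  after k t w r b = row w ⊏ 6 ∧ entry t w r b ∨ 6 ⊑ row w ∧ far (k ∸ 4) w r b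

  -- The first disjunct is the case of a white king that is too far away to assist a mate within k moves.
  lasts : ℕ → Table 6 → Placement
  lasts k t w r b = (3 ⊑ row w ∧ k + 2 ⊑ row w ∧ row b ⊏ 2) ∨ reply k (after k t) w r b

  survives : ℕ → Table 6 → Placement
  survives k t w r b =
    k + 3 ⊑ row w ∧ row b ⊏ 2 ∨
    kingMoves (λ s → col s ⊏ 7 ∧ near s b ∨ lasts k t s r b) w
    ∧ rookMoves (λ s → same s b ∨ lasts k t w s b) r

  -- Opaque, so that the type checker evaluates the tables in the certificate only.
  opaque
    survival : ℕ → Table 6
    survival zero    = table λ _ _ _ → bit true
    survival (suc k) = extend (survival k)
      where
      -- The argument is shared by all entries, so each survival table is evaluated at most once.
      extend : Table 6 → Table 6
      extend t = table (survives k t)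

    survival-sound : ∀ {k} w r b → ⟦ entry (survival (suc k)) w r b ⟧ → ⟦ survives k (survival k) w r b ⟧
    survival-sound {k} = table-sound (survives k (survival k))

  -- 13 ∸_ swaps the classes 6 and 7.
  farStays : ℕ → Table 6 → Placement
  farStays e t w r b =
    ∀close (col w) (λ x → x ⊏ M ⇒
      reply 1 (far (suc e)) (x , 13 ∸ row w) r b
      ∧ reply 1 (far e) (x , row w) r b
      ∧ (row w ≐ 6 ⇒ reply 1 (entry t) (x , 5) r b))
    ∧ rookMoves (λ s → same s b ∨ reply 1 (far e) w s b) r

  everywhere : ℕ → ℕ → Placement → Form
  everywhere lo hi φ = ∀< M λ x → ∀< hi λ y → lo ⊑ y ⇒ ∀< M λ c → ∀< 6 λ d → ∀< 7 λ p → ∀< 2 λ q →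
    p ⊏ M ∧ ~ same (c , d) (p , q) ⇒ φ (x , y) (c , d) (p , q)

  -- Covers a last move that itself brings the white king from row 3 to row 2. Such a move can check
  -- only by discovery, and the discovered check turns out not to mate.
  unmated : Placement
  unmated w r b = ~ attacks w r b ⇒
    ∀close (col w) λ x → x ⊏ M ⇒ (x ⊏ 7 ∧ near (x , 2) b) ∨ reply 0 (λ _ _ _ → bit true) (x , 2) r b

  evades : Placement → Placement
  evades good w r b = far 1 w r b ⇒ reply 1 good w r b

  sustained : ℕ → Table 6 → Placement
  sustained e t w r b = far (suc e) w r b ∧ ~ attacks w r b ⇒ farStays e t w r b

  -- start₅ and start₆ are the initial positions for n ≡ 5 and n ≡ 6, where the white king is not far away.
  closed₀ start₅ start₆ : Form
  closed₁ : Table 6 → Form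
  farClosed : ℕ → Table 6 → Form
  closed₀ = everywhere 3 8 (reply 1 (far 0)) ∧ everywhere 3 4 unmated
  closed₁ t = everywhere 6 8 (evades (far 1)) ∧ everywhere 5 6 (evades (entry t))
  farClosed e t = everywhere 6 8 (sustained e t)
  start₅ = entry (survival 4) (0 , 4) (M ∸ 1 , 5) (0 , 0)
  start₆ = entry (survival 6) (0 , 5) (M ∸ 1 , 5) (0 , 0)

  -- A step from row 6 to row 5 out of `far (suc e)` leaves `4 + e` moves, hence the tables for 4, 5
  -- and 6 moves.
  closed : Form
  closed = closed₀ ∧ closed₁ (survival 4) ∧ farClosed 1 (survival 5) ∧ farClosed 2 (survival 6) ∧ start₅ ∧ start₆

opaque
  unfolding Coarse.survival

  certificate : ∀ M → 4 ≤ M → M ≤ 8 → ⟦ Coarse.closed M ⟧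
  certificate 0 () _
  certificate 1 (s≤s ()) _
  certificate 2 (s≤s (s≤s ())) _
  certificate 3 (s≤s (s≤s (s≤s ()))) _
  certificate 4 _ _ = certify (Coarse.closed 4) refl
  certificate 5 _ _ = certify (Coarse.closed 5) refl
  certificate 6 _ _ = certify (Coarse.closed 6) refl
  certificate 7 _ _ = certify (Coarse.closed 7) refl
  certificate 8 _ _ = certify (Coarse.closed 8) refl
  certificate (suc (suc (suc (suc (suc (suc (suc (suc (suc _))))))))) _
    (s≤s (s≤s (s≤s (s≤s (s≤s (s≤s (s≤s (s≤s ()))))))))

-- Coordinates counted from the corner (m , n)

∣-∣≤1⇒Close : ∀ {a b} → ∣ a - b ∣ ≤ 1 → Close a b
∣-∣≤1⇒Close {a} {b} d = half a b d , half b a (subst (_≤ 1) (∣-∣-comm a b) d)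
  where
  half : ∀ a b → ∣ a - b ∣ ≤ 1 → a ≤ suc b
  half a b d = ≤-trans (m≤n+∣m-n∣ a b) (≤-trans (+-monoʳ-≤ b d) (≤-reflexive (+-comm b 1)))

Close⇒∣-∣≤1 : ∀ {a b} → Close a b → ∣ a - b ∣ ≤ 1
Close⇒∣-∣≤1 {zero}  {b}     (_ , q)     = q
Close⇒∣-∣≤1 {suc a} {zero}  (p , _)     = p
Close⇒∣-∣≤1 {suc a} {suc b} (s≤s p , s≤s q) = Close⇒∣-∣≤1 (p , q)

Close-∸ : ∀ k {a b} → Close a b → Close (k ∸ a) (k ∸ b)
Close-∸ k (p , q) = half q , half p
  where
  half : ∀ {a b} → b ≤ suc a → k ∸ a ≤ suc (k ∸ b)
  half {a} {b} q = ≤-trans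
    (m≤n+o⇒m∸n≤o k a (≤-trans (m≤n+m∸n k (suc a)) (≤-reflexive (sym (+-suc a (k ∸ suc a))))))
    (s≤s (∸-monoʳ-≤ k q))

∸-reflects-< : ∀ k {a b} → k ∸ a < k ∸ b → b < a
∸-reflects-< k {a} {b} h = ≰⇒> λ a≤b → <⇒≱ h (∸-monoʳ-≤ k a≤b)

Close-⊓ : ∀ k {a b} → Close a b → Close (a ⊓ k) (b ⊓ k)
Close-⊓ k (p , q) = ⊓-mono-≤ p (n≤1+n k) , ⊓-mono-≤ q (n≤1+n k)

⊓-small : ∀ {a b k} → a ⊓ k ≡ b → b < k → a ≡ b
⊓-small {a} {b} {k} eq b<k with ≤-total a k
... | inj₁ a≤k = trans (sym (m≤n⇒m⊓n≡m a≤k)) eq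
... | inj₂ k≤a = contradiction (trans (sym (m≥n⇒m⊓n≡n k≤a)) eq) (>⇒≢ b<k)

parity-cases : ∀ z → (parity z ≡ 0 × parity (suc z) ≡ 1) ⊎ (parity z ≡ 1 × parity (suc z) ≡ 0)
parity-cases zero          = inj₁ (refl , refl)
parity-cases (suc zero)    = inj₂ (refl , refl)
parity-cases (suc (suc z)) = parity-cases z

fold : ℕ → ℕ
fold y = y ⊓ 6 + parity (y ∸ 6)

parity≤1 : ∀ z → parity z ≤ 1
parity≤1 z with parity-cases z
... | inj₁ (p , _) = ≤-trans (≤-reflexive p) z≤n
... | inj₂ (p , _) = ≤-reflexive p

parity≤ : ∀ z → parity z ≤ z
parity≤ zero    = z≤n
parity≤ (suc z) = ≤-trans (parity≤1 (suc z)) (s≤s z≤n)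

fold-small : ∀ {y} → y ≤ 6 → fold y ≡ y
fold-small {y} y≤6 = trans (cong₂ _+_ (m≤n⇒m⊓n≡m y≤6) (cong parity (m≤n⇒m∸n≡0 y≤6))) (+-identityʳ y)

fold-large : ∀ {y} → 6 ≤ y → fold y ≡ 6 + parity (y ∸ 6)
fold-large {y} 6≤y = cong (_+ parity (y ∸ 6)) (m≥n⇒m⊓n≡n 6≤y)

fold≤ : ∀ y → fold y ≤ y
fold≤ y = ≤-trans (+-monoʳ-≤ (y ⊓ 6) (parity≤ (y ∸ 6)))
  (≤-reflexive (trans (cong (_+ (y ∸ 6)) (⊓-comm y 6)) (m⊓n+n∸m≡n 6 y)))

fold-≥ : ∀ {k y} → k ≤ 6 → k ≤ y → k ≤ fold y
fold-≥ {k} {y} k≤6 k≤y = ≤-trans (⊓-glb k≤y k≤6) (m≤m+n (y ⊓ 6) _)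

fold<8 : ∀ y → fold y < 8
fold<8 y = s≤s (+-mono-≤ (m⊓n≤n y 6) (parity≤1 (y ∸ 6)))

fold-small⁻ : ∀ {y} → fold y < 6 → y < 6
fold-small⁻ {y} h with y <? 6
... | yes p = p
... | no ¬p = contradiction h (≤⇒≯ (≤-trans (m≤m+n 6 _) (≤-reflexive (sym (fold-large (≮⇒≥ ¬p))))))

fold-suc : ∀ {y} → 6 ≤ y → fold (suc y) ≡ 13 ∸ fold y × fold y ≡ 13 ∸ fold (suc y)
fold-suc {y} 6≤y = flip (parity-cases (y ∸ 6)) (fold-large 6≤y)
  (trans (fold-large (m≤n⇒m≤1+n 6≤y)) (cong (λ z → 6 + parity z) (+-∸-assoc 1 6≤y)))
  where
  flip : ∀ {a b p q} → (p ≡ 0 × q ≡ 1) ⊎ (p ≡ 1 × q ≡ 0) → a ≡ 6 + p → b ≡ 6 + q → b ≡ 13 ∸ a × a ≡ 13 ∸ b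
  flip (inj₁ (refl , refl)) refl refl = refl , refl
  flip (inj₂ (refl , refl)) refl refl = refl , refl

fold-close-suc : ∀ y → Close (fold y) (fold (suc y))
fold-close-suc y with y <? 6
... | yes y<6 = subst₂ Close (sym (fold-small (<⇒≤ y<6))) (sym (fold-small y<6)) close-suc
... | no  y≮6 = subst₂ Close (sym (fold-large (≮⇒≥ y≮6))) (sym (fold-large (m≤n⇒m≤1+n (≮⇒≥ y≮6))))
  (within (parity≤1 (y ∸ 6)) , within (parity≤1 (suc y ∸ 6)))
  where
  within : ∀ {p q} → p ≤ 1 → 6 + p ≤ suc (6 + q)
  within p≤1 = +-monoʳ-≤ 6 (≤-trans p≤1 (s≤s z≤n))

fold-close : ∀ {a b} → Close a b → Close (fold a) (fold b)
fold-close {a} {b} c with closeView c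
... | below = close-sym (fold-close-suc b)
... | level = close-refl
... | above = fold-close-suc a

-- Winning within a number of moves

WinIn-suc : ∀ {m n k p} → WinIn m n k p → WinIn m n (suc k) p
WinIn-suc {k = suc k} (q , w , inj₁ mate)     = q , w , inj₁ mate
WinIn-suc {k = suc k} (q , w , inj₂ (e , h)) = q , w , inj₂ (e , λ q' b → WinIn-suc (h q' b))

WinIn-mono : ∀ {m n k l p} → k ≤ l → WinIn m n k p → WinIn m n l p
WinIn-mono {l = zero}  z≤n h = h
WinIn-mono {k = k} {suc l} k≤l h with m≤n⇒m<n∨m≡n k≤l
... | inj₁ (s≤s k≤l') = WinIn-suc (WinIn-mono k≤l' h)
... | inj₂ refl       = h

-- Without a rook there is no check, so a win would have to go on; `WinIn` then provides a black
-- move, and every such move leaves the rook off the board again.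
bare-king-draws : ∀ {m n k w b} → ¬ WinIn m n k (pos w nothing b)
bare-king-draws {k = suc k} (_ , kingMove _ _ _ _ _ , inj₁ ((_ , () , _) , _))
bare-king-draws {k = suc k} (_ , kingMove _ _ _ _ _ , inj₂ ((q , kingMove o a ≢k na nr r) , h)) =
  bare-king-draws {k = k} (h q (kingMove o a ≢k na nr r))

-- Soundness of the coarse game on the board

module Board (m n : ℕ) (5≤n : 5 ≤ n) where

  M : ℕ
  M = m ⊓ 8

  open Coarse M public

  X Y : Sq → ℕ
  X s = m ∸ col s
  Y s = n ∸ row s

  On : Sq → Set
  On = OnBoard m n

  X< : ∀ {s} → On s → X s < m
  X< ((1≤c , c≤m) , _) = ∸-monoʳ-< {m} 1≤c c≤m

  Y< : ∀ {s} → On s → Y s < n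
  Y< (_ , 1≤r , r≤n) = ∸-monoʳ-< {n} 1≤r r≤n

  place : ℕ → ℕ → Sq
  place x y = m ∸ x , n ∸ y

  place-on : ∀ {x y} → x < m → y < n → On (place x y)
  place-on {x} {y} x<m y<n = (m<n⇒0<n∸m {x} x<m , m∸n≤m m x) , (m<n⇒0<n∸m {y} y<n , m∸n≤m n y)

  X-place : ∀ {x} → x < m → m ∸ (m ∸ x) ≡ x
  X-place x<m = m∸[m∸n]≡n (<⇒≤ x<m)

  Y-place : ∀ {y} → y < n → n ∸ (n ∸ y) ≡ y
  Y-place y<n = m∸[m∸n]≡n (<⇒≤ y<n)

  X-injective : ∀ {a b} → On a → On b → X a ≡ X b → col a ≡ col b
  X-injective ((_ , p) , _) ((_ , q) , _) = ∸-cancelˡ-≡ p q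

  Y-injective : ∀ {a b} → On a → On b → Y a ≡ Y b → row a ≡ row b
  Y-injective (_ , _ , p) (_ , _ , q) = ∸-cancelˡ-≡ p q

  XY-injective : ∀ {a b} → On a → On b → X a ≡ X b → Y a ≡ Y b → a ≡ b
  XY-injective oa ob x y = cong₂ _,_ (X-injective oa ob x) (Y-injective oa ob y)

  NearXY : Sq → Sq → Set
  NearXY a b = Close (X a) (X b) × Close (Y a) (Y b)

  Adjacent⇒Near : ∀ {a b} → Adjacent a b → NearXY a b
  Adjacent⇒Near {a} {b} (_ , x , y) = Close-∸ m (∣-∣≤1⇒Close {col a} x) , Close-∸ n (∣-∣≤1⇒Close {row a} y)

  Near⇒Adjacent : ∀ {a b} → On a → On b → a ≢ b → NearXY a b → Adjacent a b
  Near⇒Adjacent ((_ , p) , _ , r) ((_ , q) , _ , s) a≢b (x , y) =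
    a≢b , back p q x , back r s y
    where
    back : ∀ {k a b} → a ≤ k → b ≤ k → Close (k ∸ a) (k ∸ b) → ∣ a - b ∣ ≤ 1
    back {k} p q c = Close⇒∣-∣≤1 (subst₂ Close (m∸[m∸n]≡n p) (m∸[m∸n]≡n q) (Close-∸ k c))

  ¬Near : ∀ {a b} → On a → On b → a ≢ b → ¬ Adjacent a b → ¬ NearXY a b
  ¬Near oa ob a≢b ¬adj near = ¬adj (Near⇒Adjacent oa ob a≢b near)

  rowClass : ℕ → ℕ
  rowClass y with suc y ≟ n
  ... | yes _ = 5
  ... | no  _ = y ⊓ 4

  rowClass<6 : ∀ y → rowClass y < 6
  rowClass<6 y with suc y ≟ n
  ... | yes _ = ≤-refl
  ... | no  _ = s≤s (≤-trans (m⊓n≤n y 4) (n≤1+n 4))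

  rowClass-bottom : ∀ {y} → suc y ≡ n → rowClass y ≡ 5
  rowClass-bottom {y} eq with suc y ≟ n
  ... | yes _  = refl
  ... | no  ¬p = contradiction eq ¬p

  rowClass-small : ∀ {y} → y < 4 → rowClass y ≡ y
  rowClass-small {y} y<4 with suc y ≟ n
  ... | yes refl = contradiction 5≤n (<⇒≱ (s≤s y<4))
  ... | no  _    = m≤n⇒m⊓n≡m (<⇒≤ y<4)

  rowClass-small⁻ : ∀ {y z} → rowClass y ≡ z → z < 4 → y ≡ z
  rowClass-small⁻ {y} eq z<4 with suc y ≟ n
  rowClass-small⁻ refl (s≤s (s≤s (s≤s (s≤s ())))) | yes _
  ... | no  _ = ⊓-small eq z<4

  rowClass-≥2 : ∀ {y} → 2 ≤ rowClass y → 2 ≤ y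
  rowClass-≥2 {y} h with suc y ≟ n
  ... | yes refl = ≤-pred (≤-trans (s≤s (s≤s (s≤s z≤n))) 5≤n)
  ... | no  _    = ≤-trans h (m⊓n≤m y 4)

  -- Kings and rooks have different row classes. But a value of `fold` below 6 is the row itself,
  -- and off the bottom row `rowClass y` never exceeds `y`.
  below-rook : ∀ {w y} → w < n → (fold w ≤ rowClass y ⊎ rowClass y ≡ 5) → w ≤ y
  below-rook {w} {y} w<n h with suc y ≟ n
  ... | yes refl = ≤-pred w<n
  below-rook {w} {y} w<n (inj₁ h) | no _ =
    ≤-trans (≤-reflexive (sym (fold-small (<⇒≤ (fold-small⁻ (s≤s (≤-trans h (≤-trans (m⊓n≤n y 4) (n≤1+n 4))))))))) (≤-trans h (m⊓n≤m y 4))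
  below-rook {w} {y} w<n (inj₂ h) | no _ = contradiction h (<⇒≢ (s≤s (m⊓n≤n y 4)))

  kingClass rookClass exact : Sq → Sq
  kingClass s = X s ⊓ 7 , fold (Y s)
  rookClass s = X s ⊓ 7 , rowClass (Y s)
  exact s     = X s , Y s

  ⊓7<M : ∀ {x} → x < m → x ⊓ 7 < M
  ⊓7<M x<m = ⊓-mono-≤ x<m ≤-refl

  -- A placement with the black king in the region where its coordinates are their own classes.
  record Placed (k r b : Sq) : Set where
    field
      onk : On k
      onr : On r
      onb : On b
      k≢r : k ≢ r
      r≢b : r ≢ b
      X<7 : X b < 7
      Y<4 : Y b < 4

  infix 4 _⊨_
  _⊨_ : Sq × Sq × Sq → Placement → Set
  (k , r , b) ⊨ φ = ⟦ φ (kingClass k) (rookClass r) (exact b) ⟧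

  -- This direction serves both uses of `~ attacks`: a square that is not attacked on classes may be
  -- entered, and a king not attacked on classes is not in check.
  attacks-complete : ∀ {k r b s} → On k → On r → On s → k ≢ r → X s < 7 → Y s < 4 →
    RookAttacks (pos k (just r) b) s → (k , r , s) ⊨ attacks
  attacks-complete {k} {r} {b} {s} onk onr ons k≢r X<7 Y<4 (_ , refl , (_ , inj₁ col≡) , open-line) =
    inj₁ (trans (m≤n⇒m⊓n≡m (≤-trans (≤-reflexive Xr≡Xs) (<⇒≤ X<7))) Xr≡Xs , λ sh → open-line (inj₁ (blocked sh)))
    where
    Xr≡Xs : X r ≡ X s
    Xr≡Xs = cong (m ∸_) col≡
    blocked : (k , r , s) ⊨ shielded → col r ≡ col s × col k ≡ col r × Btw (row r) (row k) (row s)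
    blocked (x , s<k , k≤r) = col≡ , X-injective onk onr Xk≡Xr ,
      inj₁ (∸-reflects-< n (≤∧≢⇒< Yk≤Yr λ Yk≡Yr → k≢r (XY-injective onk onr Xk≡Xr Yk≡Yr))
           , ∸-reflects-< n (<-≤-trans s<k (fold≤ (Y k))))
      where
      Yk≤Yr : Y k ≤ Y r
      Yk≤Yr = below-rook (Y< onk) k≤r
      Xk≡Xr : X k ≡ X r
      Xk≡Xr = trans (⊓-small (trans x (trans (cong (_⊓ 7) Xr≡Xs) (m≤n⇒m⊓n≡m (<⇒≤ X<7)))) X<7) (sym Xr≡Xs)
  attacks-complete {k} {r} {b} {s} onk onr ons k≢r X<7 Y<4 (_ , refl , (_ , inj₂ row≡) , _) =
    inj₂ (trans (cong rowClass (cong (n ∸_) row≡)) (rowClass-small Y<4))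

  near-complete : ∀ {k s} → X s < 7 → Y s < 4 → NearXY s k → ⟦ near (exact s) (kingClass k) ⟧
  near-complete {k} X<7 Y<4 (x , y) =
    subst (λ z → Close z (X k ⊓ 7)) (m≤n⇒m⊓n≡m (<⇒≤ X<7)) (Close-⊓ 7 x)
    , subst (λ z → Close z (fold (Y k))) (fold-small (<⇒≤ (<-≤-trans Y<4 (m≤m+n 4 2)))) (fold-close y)

  Won : ℕ → Pos → Set
  Won k q = Checkmate m n q ⊎ ((∃ λ q' → BMove m n q q') × (∀ q' → BMove m n q q' → WinIn m n k q'))

  capture-saves : ∀ {l k r b} → Placed k r b → (k , r , b) ⊨ capturable → ¬ Won l (pos k (just r) b)
  capture-saves {l} {k} {r} {b} P ((x<7 , y<4) , (cx , cy) , ¬nwr) =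
    λ { (inj₁ (_ , none)) → none _ take ; (inj₂ (_ , h)) → bare-king-draws (h _ take) }
    where
    open Placed P
    x≡ : X r ⊓ 7 ≡ X r
    x≡ = sym (⊓-small refl x<7)
    y≡ : rowClass (Y r) ≡ Y r
    y≡ = sym (rowClass-small⁻ refl y<4)
    unguarded : ¬ Adjacent r k
    unguarded adj with Adjacent⇒Near adj
    ... | (p , q) = ¬nwr (Close-⊓ 7 (close-sym p)
      , subst (Close (fold (Y k))) (trans (fold-small (<⇒≤ (<-≤-trans (subst (_< 4) y≡ y<4) (m≤m+n 4 2)))) (sym y≡)) (fold-close (close-sym q)))
    take : BMove m n (pos k (just r) b) (pos k nothing r)
    take = capture onr
      (Near⇒Adjacent onb onr (r≢b ∘ sym) (close-sym (subst (λ z → Close z (X b)) x≡ cx) , close-sym (subst (λ z → Close z (Y b)) y≡ cy)))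
      (k≢r ∘ sym) unguarded λ { (_ , refl , (r≢r , _) , _) → r≢r refl }

  corner-columns : ∀ {b r} → b < 7 → b ≡ 0 × r ⊓ 7 ≡ 1 ⊎ M < 8 × suc b ≡ M × suc (r ⊓ 7) ≡ b →
    r ≢ b × (∀ {x} → x < m → Close b x → x ≡ b ⊎ x ≡ r)
  corner-columns b<7 (inj₁ (refl , r1)) = (λ { refl → contradiction r1 λ () }) , λ _ → edge ∘ closeView
    where
    edge : ∀ {x} → CloseView 0 x → x ≡ 0 ⊎ x ≡ _
    edge level = inj₁ refl
    edge above = inj₂ (sym (⊓-small r1 (m≤m+n 2 5)))
  corner-columns {b} {r} b<7 (inj₂ (M<8 , b+ , r+)) = (λ r≡b → 1+n≢n (trans r+′ (sym r≡b))) , λ x<m → edge x<m ∘ closeView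
    where
    r+′ : suc r ≡ b
    r+′ = trans (cong suc (⊓-small refl (≤-trans (≤-reflexive r+) (<⇒≤ b<7)))) r+
    edge : ∀ {x} → x < m → CloseView b x → x ≡ b ⊎ x ≡ r
    edge x<m below = inj₂ (sym (suc-injective r+′))
    edge x<m level = inj₁ refl
    edge x<m above = contradiction (trans b+ (sym (⊓-small refl M<8))) (<⇒≢ x<m)

  stalemate-saves : ∀ {l k r b} → Placed k r b → (k , r , b) ⊨ stalemated → ¬ Won l (pos k (just r) b)
  stalemate-saves {l} {k} {r} {b} P ((Yb≡0 , fYk≡2 , 2≤cr) , Xk≡Xb′ , corner) =
    λ { (inj₁ (chk , _)) → unchecked chk ; (inj₂ ((_ , mv) , _)) → stuck mv }
    where
    open Placed P
    Yk≡2 : Y k ≡ 2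
    Yk≡2 = trans (sym (fold-small (<⇒≤ (fold-small⁻ {Y k} (subst (_< 6) (sym fYk≡2) (m≤m+n 3 3)))))) fYk≡2
    Xk≡Xb : X k ≡ X b
    Xk≡Xb = ⊓-small Xk≡Xb′ X<7
    Yr≢0 : Y r ≢ 0
    Yr≢0 = >⇒≢ (<-≤-trans (s≤s z≤n) (rowClass-≥2 2≤cr))
    Xr≢Xb : X r ≢ X b
    Xr≢Xb = proj₁ (corner-columns X<7 corner)
    unchecked : ¬ RookAttacks (pos k (just r) b) b
    unchecked (_ , refl , (_ , inj₁ c) , _) = Xr≢Xb (cong (m ∸_) c)
    unchecked (_ , refl , (_ , inj₂ c) , _) = Yr≢0 (trans (cong (n ∸_) c) Yb≡0)
    corridor : ∀ {s} → On s → Adjacent b s → s ≢ k → ¬ Adjacent s k → Y s ≡ 0 × X s ≡ X r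
    corridor {s} ons adj s≢k ¬sk with Adjacent⇒Near adj
    ... | cx , cy = top (proj₂ (corner-columns X<7 corner) (X< ons) cx) refl (closeView (subst (λ z → Close z (Y s)) Yb≡0 cy))
      where
      top : X s ≡ X b ⊎ X s ≡ X r → ∀ {y} → Y s ≡ y → CloseView 0 y → Y s ≡ 0 × X s ≡ X r
      top (inj₂ x) y level = y , x
      top (inj₁ x) y level = contradiction (XY-injective onb ons (sym x) (trans Yb≡0 (sym y))) (proj₁ adj)
      top _        y above = contradiction
        (subst₂ Close refl (sym Xk≡Xb) (close-sym cx) , subst₂ Close (sym y) (sym Yk≡2) close-suc) (¬Near ons onk s≢k ¬sk)
    stuck : ∀ {q} → ¬ BMove m n (pos k (just r) b) q
    stuck (kingMove {s = s} ons adj s≢k ¬sk ¬att _) with corridor ons adj s≢k ¬sk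
    ... | y , x = ¬att (r , refl , ((λ { refl → Yr≢0 y }) , inj₁ (sym (X-injective ons onr x))) , λ
      { (inj₁ (_ , c , _)) → Xr≢Xb (trans (sym (cong (m ∸_) c)) Xk≡Xb)
      ; (inj₂ (c , _ , _)) → Yr≢0 (trans (cong (n ∸_) c) y) })
    stuck (capture ons adj s≢k ¬sk _) = Yr≢0 (proj₁ (corridor ons adj s≢k ¬sk))

  -- The counter `κ` of the formula matters only through whether it is 0, when being out of check
  -- suffices as no white move is left. So the single formula `reply 1` serves for every `l`.
  reply-sound : ∀ κ (good : Placement) {l k r b} → Placed k r b → (κ ≡ 0 → l ≡ 0) → (k , r , b) ⊨ reply κ good →
    (∀ s → Placed k r s → ¬ (k , r , s) ⊨ attacks → (k , r , s) ⊨ good → ¬ WinIn m n l (pos k (just r) s)) →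
    ¬ Won l (pos k (just r) b)
  reply-sound κ good {l} {k} {r} {b} P last (inj₁ (κ≡0 , ¬att)) _ = λ
    { (inj₁ (chk , _))       → ¬att (attacks-complete {b = b} onk onr onb k≢r X<7 Y<4 chk)
    ; (inj₂ ((_ , mv) , h)) → subst (λ j → ¬ WinIn m n j _) (sym (last κ≡0)) id (h _ mv) }
    where open Placed P
  reply-sound κ good P _ (inj₂ (inj₁ c)) _ = capture-saves P c
  reply-sound κ good P _ (inj₂ (inj₂ (inj₁ c))) _ = stalemate-saves P c
  reply-sound κ good {l} {k} {r} {b} P _ (inj₂ (inj₂ (inj₂ (x , cx , (x<M , x<7) , y , cy , y<4 , s≢b , s≢r , ¬nk , ¬att , g)))) next =
    λ { (inj₁ (_ , none)) → none _ move ; (inj₂ (_ , h)) → next s Ps ¬att′ g′ (h _ move) }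
    where
    open Placed P
    x<m : x < m
    x<m = ≤-trans x<M (m⊓n≤m m 8)
    y<n : y < n
    y<n = ≤-trans y<4 (≤-trans (n≤1+n 4) 5≤n)
    s : Sq
    s = place x y
    exact≡ : exact s ≡ (x , y)
    exact≡ = cong₂ _,_ (X-place x<m) (Y-place y<n)
    ons : On s
    ons = place-on x<m y<n
    Xs<7 : X s < 7
    Xs<7 = subst (_< 7) (sym (X-place x<m)) x<7
    Ys<4 : Y s < 4
    Ys<4 = subst (_< 4) (sym (Y-place y<n)) y<4
    ¬att′ : ¬ (k , r , s) ⊨ attacks
    ¬att′ = subst (λ z → ¬ ⟦ attacks (kingClass k) (rookClass r) z ⟧) (sym exact≡) ¬att
    g′ : (k , r , s) ⊨ good
    g′ = subst (λ z → ⟦ good (kingClass k) (rookClass r) z ⟧) (sym exact≡) g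
    far-from-king : ¬ NearXY s k
    far-from-king c = ¬nk (subst (λ z → ⟦ near z (kingClass k) ⟧) exact≡ (near-complete {k} {s} Xs<7 Ys<4 c))
    r≢s : r ≢ s
    r≢s refl = s≢r (sym (trans (m≤n⇒m⊓n≡m (<⇒≤ Xs<7)) (X-place x<m)) , sym (trans (rowClass-small Ys<4) (Y-place y<n)))
    Ps : Placed k r s
    Ps = record { onk = onk ; onr = onr ; onb = ons ; k≢r = k≢r ; r≢b = r≢s ; X<7 = Xs<7 ; Y<4 = Ys<4 }
    move : BMove m n (pos k (just r) b) (pos k (just r) s)
    move = kingMove ons
      (Near⇒Adjacent onb ons (λ { refl → s≢b (sym (X-place x<m) , sym (Y-place y<n)) })
        (subst (Close (X b)) (sym (X-place x<m)) cx , subst (Close (Y b)) (sym (Y-place y<n)) cy))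
      (λ { refl → far-from-king (close-refl , close-refl) })
      (far-from-king ∘ Adjacent⇒Near)
      (¬att′ ∘ attacks-complete {b = b} onk onr ons k≢r Xs<7 Ys<4)
      (r≢s ∘ just-injective)

  distinct : ∀ {k r b} → Placed k r b → ¬ ⟦ same (rookClass r) (exact b) ⟧
  distinct P (x , y) = r≢b (XY-injective onr onb (⊓-small x X<7) (rowClass-small⁻ y Y<4))
    where open Placed P

  -- The converse of `near-complete`, used to discard illegal white king moves. It needs an exact
  -- column, since a king in class 7 can look adjacent to column 6 from any distance.
  near-sound : ∀ {k r b} → Placed k r b → ¬ NearXY k b → ¬ (X k ⊓ 7 < 7 × ⟦ near (kingClass k) (exact b) ⟧)
  near-sound {k} {b = b} P ¬near (x<7 , x , y@(y< , _)) =
    ¬near (subst (λ z → Close z (X b)) (sym (⊓-small refl x<7)) x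
      , subst (λ z → Close z (Y b)) (fold-small (<⇒≤ (fold-small⁻ (s≤s (≤-trans y< (≤-trans Y<4 (n≤1+n 4))))))) y)
    where open Placed P

  everywhere-at : ∀ φ {lo hi k r b} → ⟦ everywhere lo hi φ ⟧ → Placed k r b → Y b < 2 →
    ∀ y → y < hi → lo ≤ y → ⟦ φ (X k ⊓ 7 , y) (rookClass r) (exact b) ⟧
  everywhere-at φ {k = k} {r} {b} e P Yb<2 y y<hi lo≤y =
    e (X k ⊓ 7) (⊓7<M (X< onk)) y y<hi lo≤y (X r ⊓ 7) (⊓7<M (X< onr)) (rowClass (Y r)) (rowClass<6 (Y r)) (X b) X<7 (Y b) Yb<2
      (subst (_< M) (m≤n⇒m⊓n≡m (<⇒≤ X<7)) (⊓7<M (X< onb)) , distinct P)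
    where open Placed P

  white-move : ∀ {l k r b} → Placed k r b →
    (∀ s → Placed s r b → NearXY k s → ¬ NearXY s b → ¬ Won l (pos s (just r) b)) →
    (∀ s → Placed k s b → X s ≡ X r ⊎ Y s ≡ Y r → ¬ Won l (pos k (just s) b)) →
    ¬ WinIn m n (suc l) (pos k (just r) b)
  white-move P king rook (_ , kingMove {s = s} ons adj s≢b ¬sb r≢s , won) =
    king s (record { onk = ons ; onr = onr ; onb = onb ; k≢r = λ { refl → r≢s refl } ; r≢b = r≢b ; X<7 = X<7 ; Y<4 = Y<4 })
      (Adjacent⇒Near adj) (¬Near ons onb s≢b ¬sb) won
    where open Placed P
  white-move P king rook (_ , rookMove {s = s} ons (_ , line) _ _ s≢k s≢b , won) =
    rook s (record { onk = onk ; onr = ons ; onb = onb ; k≢r = s≢k ∘ sym ; r≢b = s≢b ; X<7 = X<7 ; Y<4 = Y<4 })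
      ([ (λ c → inj₁ (sym (cong (m ∸_) c))) , (λ c → inj₂ (sym (cong (n ∸_) c))) ]′ line) won
    where open Placed P

  king-class : ∀ {φ k s} → ⟦ kingMoves φ (kingClass k) ⟧ → On s → NearXY k s → ⟦ φ (kingClass s) ⟧
  king-class h ons (x , y) = h _ (Close-⊓ 7 x) (⊓7<M (X< ons)) _ (fold-close y)

  rook-class : ∀ {φ r s} → ⟦ rookMoves φ (rookClass r) ⟧ → On s → X s ≡ X r ⊎ Y s ≡ Y r → ⟦ φ (rookClass s) ⟧
  rook-class {φ} {r} {s} (_ , h) ons (inj₁ x) = subst (λ z → ⟦ φ (z ⊓ 7 , rowClass (Y s)) ⟧) (sym x) (h _ (rowClass<6 (Y s)))
  rook-class {φ} {r} {s} (h , _) ons (inj₂ y) = subst (λ z → ⟦ φ (X s ⊓ 7 , rowClass z) ⟧) (sym y) (h _ (⊓7<M (X< ons)))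

  -- Black's survival on the board

  module Survival (proven : ⟦ closed ⟧) where

    -- The coarse form of Black not being in check with White to move, which the certificate assumes
    -- in `unmated` and `sustained`; `legal` restores it after each reply.
    Unattacked : Sq → Sq → Sq → Set
    Unattacked k r b = ¬ (k , r , b) ⊨ attacks

    -- While the white king is on row 3 or lower on the board, a black king on the top two rows can
    -- always reply within them or take the rook. White's budget allows row 2 to be reached only by
    -- the last move, which is the case of `unmated`.
    safe₀ : ∀ l {k r b} → Placed k r b → Unattacked k r b → Y b < 2 → l + 2 ≤ Y k → ¬ WinIn m n l (pos k (just r) b)
    lasts₀ : ∀ l {k r b} → Placed k r b → Y b < 2 → 3 ≤ Y k → l + 2 ≤ Y k → ¬ Won l (pos k (just r) b)

    safe₀ zero    P _ _ _ ()
    safe₀ (suc l) {k} {r} {b} P ¬att Yb<2 l+3≤Yk = white-move P king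
      λ s Ps _ → lasts₀ l Ps Yb<2 (≤-trans (s≤s (m≤n+m 2 l)) l+3≤Yk) (<⇒≤ l+3≤Yk)
      where
      king : ∀ s → Placed s r b → NearXY k s → ¬ NearXY s b → ¬ Won l (pos s (just r) b)
      king s Ps step@(_ , (Yk≤ , _)) ¬near with 3 ≤? Y s
      ... | yes 3≤Ys = lasts₀ l Ps Yb<2 3≤Ys (≤-pred (≤-trans l+3≤Yk Yk≤))
      ... | no  3≰Ys = last₀ (everywhere-at unmated (proj₂ (proj₁ proven)) P Yb<2 3 ≤-refl ≤-refl
          (subst (λ z → ¬ ⟦ attacks (X k ⊓ 7 , z) (rookClass r) (exact b) ⟧) (at 3 (m≤m+n 3 3) Yk≡3) ¬att)
          (X s ⊓ 7) (Close-⊓ 7 (proj₁ step)) (⊓7<M (X< (Placed.onk Ps))))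
        where
        at : ∀ y → y ≤ 6 → ∀ {z} → z ≡ y → fold z ≡ y
        at y y≤6 refl = fold-small y≤6
        Ys≤2 : Y s ≤ 2
        Ys≤2 = ≤-pred (≰⇒> 3≰Ys)
        l+2≤2 : l + 2 ≤ 2
        l+2≤2 = ≤-trans (≤-pred (≤-trans l+3≤Yk Yk≤)) Ys≤2
        l≡0 : l ≡ 0
        l≡0 = n≤0⇒n≡0 (+-cancelʳ-≤ 2 l 0 l+2≤2)
        Yk≡3 : Y k ≡ 3
        Yk≡3 = ≤-antisym (≤-trans Yk≤ (s≤s Ys≤2)) (≤-trans (s≤s (m≤n+m 2 l)) l+3≤Yk)
        Ys≡2 : Y s ≡ 2
        Ys≡2 = ≤-antisym Ys≤2 (≤-pred (≤-trans (≤-reflexive (sym Yk≡3)) Yk≤))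
        last₀ : ⟦ (X s ⊓ 7 ⊏ 7 ∧ near (X s ⊓ 7 , 2) (exact b)) ∨ reply 0 (λ _ _ _ → bit true) (X s ⊓ 7 , 2) (rookClass r) (exact b) ⟧ →
          ¬ Won l (pos s (just r) b)
        last₀ h = rows (subst (λ z → ⟦ (X s ⊓ 7 ⊏ 7 ∧ near (X s ⊓ 7 , z) (exact b)) ∨
            reply 0 (λ _ _ _ → bit true) (X s ⊓ 7 , z) (rookClass r) (exact b) ⟧)
          (sym (at 2 (m≤m+n 2 4) Ys≡2)) h)
          where
          rows : X s ⊓ 7 < 7 × ⟦ near (kingClass s) (exact b) ⟧ ⊎ (s , r , b) ⊨ reply 0 (λ _ _ _ → bit true) → ¬ Won l (pos s (just r) b)
          rows (inj₁ h) = contradiction h (near-sound Ps ¬near)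
          rows (inj₂ h) = reply-sound 0 (λ _ _ _ → bit true) Ps (λ _ → l≡0) h λ _ _ _ _ → subst (λ j → ¬ WinIn m n j _) (sym l≡0) id

    lasts₀ l {k} P Yb<2 3≤Yk l+2≤Yk = reply-sound 1 (far 0) P (λ ())
      (everywhere-at (reply 1 (far 0)) (proj₁ (proj₁ proven)) P Yb<2 (fold (Y k)) (fold<8 (Y k)) (fold-≥ (m≤m+n 3 3) 3≤Yk))
      λ s Ps ¬att Ys<2 → safe₀ l Ps ¬att Ys<2 l+2≤Yk

    -- Mutual induction on `l`, split where the row classes of the white king stop being exact. The
    -- bound `l ≤ 6` ensures that a king going back from row 5 to row 6 has at most 5 moves left, so
    -- that `far 0` and `far 1` suffice there.
    Near₆ Far₆ : ℕ → Set
    Near₆ l = ∀ {k r b} → Placed k r b → Unattacked k r b → Y k < 6 → l ≤ 6 →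
      (k , r , b) ⊨ entry (survival l) → ¬ WinIn m n l (pos k (just r) b)
    Far₆ l = ∀ e → e < 3 → ∀ {k r b} → Placed k r b → Unattacked k r b → 6 ≤ Y k → l + 2 ≡ Y k + suc e →
      (k , r , b) ⊨ far (suc e) → ¬ WinIn m n l (pos k (just r) b)

    near₆ : ∀ l → Near₆ l
    far₆  : ∀ l → Far₆ l

    near₆ zero    _ _ _ _ _ ()
    near₆ (suc l) {k} {r} {b} P ¬att Yk<6 l<6 en with survival-sound _ _ _ en
    ... | inj₁ (l+3≤ , Yb<2) = safe₀ (suc l) P ¬att Yb<2
      (≤-trans (≤-reflexive (sym (+-suc l 2))) (≤-trans l+3≤ (fold≤ (Y k))))
    ... | inj₂ (kings , rooks) = white-move P king rook
      where
      later : ∀ s r′ → Placed s r′ b → Y s ≤ 6 → ⟦ lasts l (survival l) (kingClass s) (rookClass r′) (exact b) ⟧ →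
        ¬ Won l (pos s (just r′) b)
      later s r′ Ps Ys≤6 (inj₁ (3≤ , l+2≤ , Yb<2)) = lasts₀ l Ps Yb<2 (≤-trans 3≤ (fold≤ _)) (≤-trans l+2≤ (fold≤ _))
      later s r′ Ps Ys≤6 (inj₂ h) = reply-sound l (after l (survival l)) Ps id h λ
        { b′ Pb ¬att′ (inj₁ (fs<6 , en′)) → near₆ l Pb ¬att′ (fold-small⁻ fs<6) (<⇒≤ l<6) en′
        ; b′ Pb ¬att′ (inj₂ (6≤fs , f)) → turned-back Pb ¬att′ (≤-antisym Ys≤6 (≤-trans 6≤fs (fold≤ _))) f }
        where
        turned-back : ∀ {b′} → Placed s r′ b′ → Unattacked s r′ b′ → Y s ≡ 6 → (s , r′ , b′) ⊨ far (l ∸ 4) →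
          ¬ WinIn m n l (pos s (just r′) b′)
        turned-back Pb ¬att′ Ys≡6 f with l ≤? 4
        ... | yes l≤4 rewrite m≤n⇒m∸n≡0 l≤4 = safe₀ l Pb ¬att′ f (≤-trans (+-monoˡ-≤ 2 l≤4) (≤-reflexive (sym Ys≡6)))
        ... | no  l≰4 = far₆ l 0 (s≤s z≤n) Pb ¬att′ (≤-reflexive (sym Ys≡6))
          (trans (cong (_+ 2) l≡5) (cong (_+ 1) (sym Ys≡6)))
          (subst (λ j → ⟦ far (j ∸ 4) (kingClass s) (rookClass r′) _ ⟧) l≡5 f)
          where
          l≡5 : l ≡ 5
          l≡5 = ≤-antisym (≤-pred l<6) (≰⇒> l≰4)
      king : ∀ s → Placed s r b → NearXY k s → ¬ NearXY s b → ¬ Won l (pos s (just r) b)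
      king s Ps step ¬near with
        king-class {λ z → (col z ⊏ 7 ∧ near z (exact b)) ∨ lasts l (survival l) z (rookClass r) (exact b)} {k} kings (Placed.onk Ps) step
      ... | inj₁ h = contradiction h (near-sound Ps ¬near)
      ... | inj₂ h = later s r Ps (≤-trans (proj₂ (proj₂ step)) Yk<6) h
      rook : ∀ s → Placed k s b → X s ≡ X r ⊎ Y s ≡ Y r → ¬ Won l (pos k (just s) b)
      rook s Ps line with
        rook-class {λ z → same z (exact b) ∨ lasts l (survival l) (kingClass k) z (exact b)} {r} rooks (Placed.onr Ps) line
      ... | inj₁ h = contradiction h (distinct Ps)
      ... | inj₂ h = later k s Ps (<⇒≤ Yk<6) h

    far₆ zero    _ _ _ _ _ _ _ ()
    -- At index 1 only a step up keeps the surplus; any other move brings it to 0 or below and is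
    -- answered by `lasts₀`.
    far₆ (suc l) zero _ {k} {r} {b} P ¬att 6≤Yk l+3≡ f = white-move P king
      λ s Ps _ → lasts₀ l Ps (proj₁ f) (≤-trans (m≤m+n 3 3) 6≤Yk) (≤-reflexive l+2≡Yk)
      where
      l+2≡Yk : l + 2 ≡ Y k
      l+2≡Yk = suc-injective (trans l+3≡ (+-comm (Y k) 1))
      king : ∀ s → Placed s r b → NearXY k s → ¬ NearXY s b → ¬ Won l (pos s (just r) b)
      king s Ps near _ = go refl refl (closeView (proj₂ near))
        where
        late : ∀ {y} → Y k ≡ y → y ≤ Y s → ¬ Won l (pos s (just r) b)
        late refl y≤ = lasts₀ l Ps (proj₁ f) (≤-trans (m≤m+n 3 3) (≤-trans 6≤Yk y≤)) (≤-trans (≤-reflexive l+2≡Yk) y≤)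
        go : ∀ {yk ys} → Y k ≡ yk → Y s ≡ ys → CloseView yk ys → ¬ Won l (pos s (just r) b)
        go yk ys level = late yk (≤-reflexive (sym ys))
        go yk ys above = late yk (≤-trans (n≤1+n _) (≤-reflexive (sym ys)))
        go {ys = y} yk ys below with 6 ≤? y
        ... | yes 6≤y = reply-sound 1 (far 1) Ps (λ ())
            (everywhere-at (evades (far 1)) (proj₁ (proj₁ (proj₂ proven))) Ps (proj₁ f) (fold (Y s)) (fold<8 (Y s)) (fold-≥ ≤-refl 6≤Ys) f)
            λ _ Pb ¬att′ f′ → far₆ l 0 (s≤s z≤n) Pb ¬att′ 6≤Ys (trans l+2≡Yk (trans yk (trans (cong suc (sym ys)) (+-comm 1 (Y s))))) f′
          where
          6≤Ys : 6 ≤ Y s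
          6≤Ys = ≤-trans 6≤y (≤-reflexive (sym ys))
        ... | no  6≰y = reply-sound 1 (entry (survival 4)) Ps (λ ())
            (subst (λ z → ⟦ reply 1 (entry (survival 4)) (X s ⊓ 7 , z) (rookClass r) (exact b) ⟧) (sym fYs≡5)
              (everywhere-at (evades (entry (survival 4))) (proj₂ (proj₁ (proj₂ proven))) Ps (proj₁ f) 5 ≤-refl ≤-refl f))
            λ _ Pb ¬att′ en → near₆ l Pb ¬att′ (≤-reflexive (cong suc Ys≡5)) (≤-trans (≤-reflexive l≡4) (m≤m+n 4 2))
              (subst (λ j → ⟦ entry (survival j) _ _ _ ⟧) (sym l≡4) en)
          where
          y≡5 : y ≡ 5
          y≡5 = ≤-antisym (≤-pred (≰⇒> 6≰y)) (≤-pred (≤-trans 6≤Yk (≤-reflexive yk)))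
          Ys≡5 : Y s ≡ 5
          Ys≡5 = trans ys y≡5
          fYs≡5 : fold (Y s) ≡ 5
          fYs≡5 = trans (fold-small (≤-trans (≤-reflexive Ys≡5) (m≤m+n 5 1))) Ys≡5
          l≡4 : l ≡ 4
          l≡4 = +-cancelʳ-≡ 2 l 4 (trans l+2≡Yk (trans yk (cong suc y≡5)))
    far₆ (suc l) (suc e) (s≤s e<2) {k} {r} {b} P ¬att 6≤Yk l+3≡ f = white-move P king rook
      where
      l+2≡ : l + 2 ≡ Y k + suc e
      l+2≡ = suc-injective (trans l+3≡ (+-suc (Y k) (suc e)))
      guard : ∀ e {w r b} → ⟦ far (suc (suc e)) w r b ⟧ → ⟦ far 1 w r b ⟧
      guard zero    = proj₁
      guard (suc e) = proj₁
      farStays-closed : ∀ e → e < 2 → ⟦ farClosed (suc e) (survival (5 + e)) ⟧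
      farStays-closed 0 _ = proj₁ (proj₂ (proj₂ proven))
      farStays-closed 1 _ = proj₁ (proj₂ (proj₂ (proj₂ proven)))
      farStays-closed (suc (suc _)) (s≤s (s≤s ()))
      stays : (k , r , b) ⊨ farStays (suc e) (survival (5 + e))
      stays = everywhere-at (sustained (suc e) (survival (5 + e)))
        (farStays-closed e e<2) P (proj₁ (guard e f)) (fold (Y k)) (fold<8 (Y k)) (fold-≥ ≤-refl 6≤Yk) (f , ¬att)
      king : ∀ s → Placed s r b → NearXY k s → ¬ NearXY s b → ¬ Won l (pos s (just r) b)
      king s Ps near _ with proj₁ stays (X s ⊓ 7) (Close-⊓ 7 (proj₁ near)) (⊓7<M (X< (Placed.onk Ps)))
      ... | other , same , last = go refl refl (closeView (proj₂ near))
        where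
        row-is : ∀ {φ y} → fold (Y s) ≡ y → ⟦ reply 1 φ (X s ⊓ 7 , y) (rookClass r) (exact b) ⟧ → (s , r , b) ⊨ reply 1 φ
        row-is refl h = h
        go : ∀ {yk ys} → Y k ≡ yk → Y s ≡ ys → CloseView yk ys → ¬ Won l (pos s (just r) b)
        go yk ys level = reply-sound 1 (far (suc e)) Ps (λ ()) (row-is {far (suc e)} (cong fold Ys≡Yk) same)
          λ _ Pb ¬att′ f′ → far₆ l e (≤-trans e<2 (n≤1+n 2)) Pb ¬att′ (≤-trans 6≤Yk (≤-reflexive (sym Ys≡Yk)))
            (trans l+2≡ (cong (_+ suc e) (sym Ys≡Yk))) f′
          where
          Ys≡Yk : Y s ≡ Y k
          Ys≡Yk = trans ys (sym yk)
        go yk ys above = reply-sound 1 (far (suc (suc e))) Ps (λ ())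
          (row-is {far (suc (suc e))} (trans (cong fold Ys≡) (proj₁ (fold-suc 6≤Yk))) other)
          (retreat e e<2 l+2≡)
          where
          Ys≡ : Y s ≡ suc (Y k)
          Ys≡ = trans ys (cong suc (sym yk))
          6≤Ys : 6 ≤ Y s
          6≤Ys = ≤-trans (m≤n⇒m≤1+n 6≤Yk) (≤-reflexive (sym Ys≡))
          -- A retreat lowers the index by two but lands in the same row class as an advance, so the
          -- reply found for the advance serves here too: its `far (suc (suc e))` contains the
          -- weaker condition that is now needed.
          retreat : ∀ e → e < 2 → l + 2 ≡ Y k + suc e → ∀ b′ → Placed s r b′ → Unattacked s r b′ →
            (s , r , b′) ⊨ far (suc (suc e)) → ¬ WinIn m n l (pos s (just r) b′)
          retreat 0 _ eq _ Pb ¬att′ f′ = safe₀ l Pb ¬att′ (proj₁ (proj₁ f′)) (≤-reflexive (trans eq (trans (+-comm (Y k) 1) (sym Ys≡))))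
          retreat 1 _ eq _ Pb ¬att′ f′ = far₆ l 0 (s≤s z≤n) Pb ¬att′ 6≤Ys
            (trans eq (trans (+-suc (Y k) 1) (cong (_+ 1) (sym Ys≡)))) (proj₁ f′)
          retreat (suc (suc _)) (s≤s (s≤s ()))
        go {ys = y} yk ys below with 6 ≤? y
        ... | yes 6≤y = reply-sound 1 (far (suc (suc e))) Ps (λ ()) (row-is {far (suc (suc e))} fold≡ other)
            λ _ Pb ¬att′ f′ → far₆ l (suc e) (s≤s e<2) Pb ¬att′ 6≤Ys
              (trans l+2≡ (trans (cong (_+ suc e) Yk≡) (sym (+-suc (Y s) (suc e))))) f′
          where
          6≤Ys : 6 ≤ Y s
          6≤Ys = ≤-trans 6≤y (≤-reflexive (sym ys))
          Yk≡ : Y k ≡ suc (Y s)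
          Yk≡ = trans yk (cong suc (sym ys))
          fold≡ : fold (Y s) ≡ 13 ∸ fold (Y k)
          fold≡ = trans (proj₂ (fold-suc 6≤Ys)) (cong (λ z → 13 ∸ fold z) (sym Yk≡))
        ... | no  6≰y = reply-sound 1 (entry (survival (5 + e))) Ps (λ ())
            (row-is {entry (survival (5 + e))} fYs≡5 (last (cong fold Yk≡6)))
            λ _ Pb ¬att′ en → near₆ l Pb ¬att′ (≤-reflexive (cong suc Ys≡5)) (≤-trans (≤-reflexive l≡) (+-monoʳ-≤ 5 (≤-pred e<2)))
              (subst (λ j → ⟦ entry (survival j) _ _ _ ⟧) (sym l≡) en)
          where
          y≡5 : y ≡ 5
          y≡5 = ≤-antisym (≤-pred (≰⇒> 6≰y)) (≤-pred (≤-trans 6≤Yk (≤-reflexive yk)))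
          Ys≡5 : Y s ≡ 5
          Ys≡5 = trans ys y≡5
          Yk≡6 : Y k ≡ 6
          Yk≡6 = trans yk (cong suc y≡5)
          fYs≡5 : fold (Y s) ≡ 5
          fYs≡5 = trans (fold-small (≤-trans (≤-reflexive Ys≡5) (m≤m+n 5 1))) Ys≡5
          l≡ : l ≡ 5 + e
          l≡ = +-cancelʳ-≡ 2 l (5 + e) (trans l+2≡ (trans (cong (_+ suc e) Yk≡6) (cong (5 +_) (+-comm 2 e))))
      rook : ∀ s → Placed k s b → X s ≡ X r ⊎ Y s ≡ Y r → ¬ Won l (pos k (just s) b)
      rook s Ps line with
        rook-class {λ z → same z (exact b) ∨ reply 1 (far (suc e)) (kingClass k) z (exact b)} {r} (proj₂ stays) (Placed.onr Ps) line
      ... | inj₁ h = contradiction h (distinct Ps)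
      ... | inj₂ h = reply-sound 1 (far (suc e)) Ps (λ ()) h λ _ Pb ¬att′ f′ → far₆ l e (≤-trans e<2 (n≤1+n 2)) Pb ¬att′ 6≤Yk l+2≡ f′

-- Lower bound at the initial position

parity≡%2 : ∀ z → parity z ≡ z % 2
parity≡%2 0             = refl
parity≡%2 1             = refl
parity≡%2 (suc (suc z)) = trans (parity≡%2 z) (trans (sym ([m+n]%n≡m%n z 2)) (cong (_% 2) (+-comm z 2)))

parity-fold : ∀ {y} → 6 ≤ y → parity (fold y) ≡ parity y
parity-fold {y} 6≤y = trans (cong parity (fold-large 6≤y)) (trans (idem (y ∸ 6)) (cong parity (m+[n∸m]≡n 6≤y)))
  where
  idem : ∀ z → parity (parity z) ≡ parity z
  idem z with parity-cases z
  ... | inj₁ (p , _) = trans (cong parity p) (sym p)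
  ... | inj₂ (p , _) = trans (cong parity p) (sym p)

parity-pred : ∀ {y p} → parity (suc y) ≡ p → parity y ≡ 1 ∸ p
parity-pred {y} refl with parity-cases y
... | inj₁ (p , q) = trans p (cong (1 ∸_) (sym q))
... | inj₂ (p , q) = trans p (cong (1 ∸_) (sym q))

module LowerBound (m n : ℕ) (4≤m : 4 ≤ suc m) (5≤n : 5 ≤ suc n) where

  open Board (suc m) (suc n) 5≤n

  proven : ⟦ closed ⟧
  proven = certificate M (⊓-glb 4≤m (m≤m+n 4 4)) (m⊓n≤n (suc m) 8)

  open Survival proven

  k r b : Sq
  k = suc m , 1
  r = 1 , 1
  b = suc m , suc n

  Xb≡0 : X b ≡ 0
  Xb≡0 = n∸n≡0 m

  Yb≡0 : Y b ≡ 0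
  Yb≡0 = n∸n≡0 n

  placed : Placed k r b
  placed = record
    { onk = (s≤s z≤n , ≤-refl) , s≤s z≤n , s≤s z≤n
    ; onr = (s≤s z≤n , s≤s z≤n) , s≤s z≤n , s≤s z≤n
    ; onb = (s≤s z≤n , ≤-refl) , s≤s z≤n , ≤-refl
    ; k≢r = λ eq → contradiction (suc-injective (cong col eq)) (>⇒≢ (≤-trans (s≤s z≤n) (≤-pred 4≤m)))
    ; r≢b = λ eq → contradiction (suc-injective (sym (cong row eq))) (>⇒≢ (≤-trans (s≤s z≤n) (≤-pred 5≤n)))
    ; X<7 = ≤-trans (≤-reflexive (cong suc Xb≡0)) (s≤s z≤n)
    ; Y<4 = ≤-trans (≤-reflexive (cong suc Yb≡0)) (s≤s z≤n) }

  rook-row : rowClass (Y r) ≡ 5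
  rook-row = rowClass-bottom refl

  unattacked : Unattacked k r b
  unattacked (inj₁ (x , _)) = contradiction (trans x Xb≡0) (>⇒≢ (⊓-glb (≤-trans (s≤s z≤n) (≤-pred 4≤m)) (s≤s z≤n)))
  unattacked (inj₂ y)       = contradiction (trans (sym rook-row) (trans y Yb≡0)) λ ()

  Xk⊓7≡0 : X k ⊓ 7 ≡ 0
  Xk⊓7≡0 = cong (_⊓ 7) (n∸n≡0 m)

  start-entry : ∀ {l} → n < 6 → l ≤ 6 → ⟦ entry (survival l) (0 , n) (M ∸ 1 , 5) (0 , 0) ⟧ →
    ¬ WinIn (suc m) (suc n) l (start (suc m) (suc n))
  start-entry {l} n<6 l≤6 h = near₆ l placed unattacked n<6 l≤6
    (subst₂ (λ k b → ⟦ entry (survival l) k (rookClass r) b ⟧)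
      (cong₂ _,_ (sym Xk⊓7≡0) (sym (fold-small (<⇒≤ n<6)))) (cong₂ _,_ (sym Xb≡0) (sym Yb≡0))
      (subst (λ y → ⟦ entry (survival l) (0 , n) (M ∸ 1 , y) (0 , 0) ⟧) (sym rook-row) h))

  far₁ : (k , r , b) ⊨ far 1
  far₁ = ≤-trans (≤-reflexive (cong suc Yb≡0)) (s≤s z≤n) , ≤-trans (≤-reflexive (cong suc Xb≡0)) (s≤s z≤n)

  four-or-five : n < 6 → n ≡ 4 ⊎ n ≡ 5
  four-or-five n<6 with m≤n⇒m<n∨m≡n (≤-pred n<6)
  ... | inj₂ n≡5 = inj₂ n≡5
  ... | inj₁ n<5 = inj₁ (≤-antisym (≤-pred n<5) (≤-pred 5≤n))

  -- With `n` moves and the white king on row `n` the index is 2. Row `n` is even, which is what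
  -- `far 2` asks for while the rook is at home and the black king in the corner.
  odd-bound : suc n % 2 ≡ 1 → ¬ WinIn (suc m) (suc n) n (start (suc m) (suc n))
  odd-bound odd with n <? 6
  ... | no n≮6 = far₆ n 1 (s≤s (s≤s z≤n)) placed unattacked (≮⇒≥ n≮6) refl
    (far₁ , inj₂ ((Xk⊓7≡0 , Xb≡0 , rook-row) , inj₂ (refl , Yb≡0 ,
      trans (parity-fold (≮⇒≥ n≮6)) (parity-pred {n} (trans (parity≡%2 (suc n)) odd)))))
  ... | yes n<6 with four-or-five n<6
  ...   | inj₁ refl = start-entry n<6 (m≤m+n 4 2) (proj₁ (proj₂ (proj₂ (proj₂ (proj₂ proven)))))
  ...   | inj₂ refl = contradiction odd λ ()

  -- One more move raises the index to 3, where `far` asks for the opposite parity of the white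
  -- king's row.
  even-bound : suc n % 2 ≡ 0 → ¬ WinIn (suc m) (suc n) (suc n) (start (suc m) (suc n))
  even-bound even with n <? 6
  ... | no n≮6 = far₆ (suc n) 2 ≤-refl placed unattacked (≮⇒≥ n≮6) (sym (+-suc n 2))
    (far₁ , (rook-row , refl) , inj₂ (Xk⊓7≡0 , (Xb≡0 , Yb≡0) ,
      trans (parity-fold (≮⇒≥ n≮6)) (parity-pred {n} (trans (parity≡%2 (suc n)) even))))
  ... | yes n<6 with four-or-five n<6
  ...   | inj₁ refl = contradiction even λ ()
  ...   | inj₂ refl = start-entry n<6 ≤-refl (proj₂ (proj₂ (proj₂ (proj₂ (proj₂ proven)))))

-- Upper bound

half : ∀ z → parity z ≡ 0 → ∃ λ j → z ≡ j + j
half 0             _ = 0 , refl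
half 1             ()
half (suc (suc z)) p with half z p
... | j , refl = suc j , cong suc (sym (+-suc j j))

module UpperBound (m n : ℕ) (4≤m : 4 ≤ m) (5≤n : 5 ≤ n) where

  open Board m n 5≤n

  record At (s : Sq) (x y : ℕ) : Set where
    constructor at
    field
      on : On s
      Xs : X s ≡ x
      Ys : Y s ≡ y
  open At

  at-place : ∀ {x y} → x < m → y < n → At (place x y) x y
  at-place x<m y<n = at (place-on x<m y<n) (X-place x<m) (Y-place y<n)

  at-≢ : ∀ {a b x y x′ y′} → At a x y → At b x′ y′ → x ≢ x′ ⊎ y ≢ y′ → a ≢ b
  at-≢ A B (inj₁ x≢) refl = x≢ (trans (sym (Xs A)) (Xs B))
  at-≢ A B (inj₂ y≢) refl = y≢ (trans (sym (Ys A)) (Ys B))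

  at-≡ : ∀ {a b x y} → At a x y → At b x y → a ≡ b
  at-≡ A B = XY-injective (on A) (on B) (trans (Xs A) (sym (Xs B))) (trans (Ys A) (sym (Ys B)))

  at-near : ∀ {a b x y x′ y′} → At a x y → At b x′ y′ → Close x x′ → Close y y′ → NearXY a b
  at-near A B cx cy = subst₂ Close (sym (Xs A)) (sym (Xs B)) cx , subst₂ Close (sym (Ys A)) (sym (Ys B)) cy

  at-near⁻ : ∀ {a b x y x′ y′} → At a x y → At b x′ y′ → NearXY a b → Close x x′ × Close y y′
  at-near⁻ A B (cx , cy) = subst₂ Close (Xs A) (Xs B) cx , subst₂ Close (Ys A) (Ys B) cy

  col-≢ : ∀ {a b x y x′ y′} → At a x y → At b x′ y′ → x ≢ x′ → col a ≢ col b
  col-≢ A B x≢ c = x≢ (trans (sym (Xs A)) (trans (cong (m ∸_) c) (Xs B)))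

  row-≢ : ∀ {a b x y x′ y′} → At a x y → At b x′ y′ → y ≢ y′ → row a ≢ row b
  row-≢ A B y≢ c = y≢ (trans (sym (Ys A)) (trans (cong (n ∸_) c) (Ys B)))

  column-attack : ∀ {k r b s x y x′ y′ y″} → At k x y → At r x′ y′ → At s x′ y″ → x ≢ x′ → y′ ≢ y″ → RookAttacks (pos k (just r) b) s
  column-attack K R S x≢ y≢ = _ , refl , (at-≢ R S (inj₂ y≢) , inj₁ (X-injective (on R) (on S) (trans (Xs R) (sym (Xs S))))) , λ
    { (inj₁ (_ , c , _)) → col-≢ K R x≢ c
    ; (inj₂ (c , _)) → row-≢ R S y≢ c }

  row-attack : ∀ {k r b s x y x′ y′ x″} → At k x y → At r x′ y′ → At s x″ y′ → y ≢ y′ → x′ ≢ x″ → RookAttacks (pos k (just r) b) s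
  row-attack K R S y≢ x≢ = _ , refl , (at-≢ R S (inj₁ x≢) , inj₂ (Y-injective (on R) (on S) (trans (Ys R) (sym (Ys S))))) , λ
    { (inj₁ (c , _)) → col-≢ R S x≢ c
    ; (inj₂ (_ , c , _)) → row-≢ K R y≢ c }

  no-attack : ∀ {k r b s x y x′ y′} → At r x y → At s x′ y′ → x ≢ x′ → y ≢ y′ → ¬ RookAttacks (pos k (just r) b) s
  no-attack R S x≢ y≢ (_ , refl , (_ , inj₁ c) , _) = col-≢ R S x≢ c
  no-attack R S x≢ y≢ (_ , refl , (_ , inj₂ c) , _) = row-≢ R S y≢ c

  king-step : ∀ {k r b s x y x′ y′ x″ y″} → At k x y → At s x′ y′ → At b x″ y″ → Close x x′ → Close y y′ →
    k ≢ s → ¬ (Close x′ x″ × Close y′ y″) → r ≢ s → WMove m n (pos k (just r) b) (pos s (just r) b)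
  king-step {b = b} {s = s} K S B cx cy k≢s ¬near r≢s = kingMove (on S) (Near⇒Adjacent (on K) (on S) k≢s (at-near K S cx cy))
    (λ { refl → ¬near′ (close-refl , close-refl) }) (¬near′ ∘ Adjacent⇒Near) (r≢s ∘ just-injective)
    where
    ¬near′ : ¬ NearXY s b
    ¬near′ = ¬near ∘ at-near⁻ S B

  black-step : ∀ {k r b s x y x′ y′ x″ y″} → At b x y → At s x′ y′ → At k x″ y″ → Close x x′ → Close y y′ →
    b ≢ s → ¬ (Close x′ x″ × Close y′ y″) → ¬ RookAttacks (pos k (just r) b) s → r ≢ s →
    BMove m n (pos k (just r) b) (pos k (just r) s)
  black-step {k = k} {s = s} B S K cx cy b≢s ¬near ¬att r≢s = kingMove (on S) (Near⇒Adjacent (on B) (on S) b≢s (at-near B S cx cy))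
    (λ { refl → ¬near′ (close-refl , close-refl) }) (¬near′ ∘ Adjacent⇒Near) ¬att (r≢s ∘ just-injective)
    where
    ¬near′ : ¬ NearXY s k
    ¬near′ = ¬near ∘ at-near⁻ S K

  black-moves : ∀ {k r b q x y x′ y′ x″ y″} (Z : Pos → Set) → At k x y → At r x′ y′ → At b x″ y″ → ¬ (Close x″ x′ × Close y″ y′) →
    (∀ s {u v} → At s u v → Close x″ u → Close y″ v → b ≢ s → ¬ (Close u x × Close v y) →
      ¬ RookAttacks (pos k (just r) b) s → Z (pos k (just r) s)) →
    BMove m n (pos k (just r) b) q → Z q
  black-moves Z K R B ¬br go (kingMove {s = s} ons adj s≢k ¬sk ¬att _) with at-near⁻ B (at ons refl refl) (Adjacent⇒Near adj)
  ... | cx , cy = go s (at ons refl refl) cx cy (proj₁ adj) (¬Near ons (on K) s≢k ¬sk ∘ uncurry (at-near (at ons refl refl) K)) ¬att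
  black-moves Z K R B ¬br go (capture _ adj _ _ _) = contradiction (at-near⁻ B R (Adjacent⇒Near adj)) ¬br

  far-apart : ∀ {a b} → suc (suc a) ≤ b → ¬ Close a b × ¬ Close b a
  far-apart p = (λ { (_ , q) → <⇒≱ (s≤s p) (s≤s q) }) , (λ { (q , _) → <⇒≱ (s≤s p) (s≤s q) })

  0<m : 0 < m
  0<m = ≤-trans (s≤s z≤n) 4≤m
  1<m : 1 < m
  1<m = ≤-trans (s≤s (s≤s z≤n)) 4≤m
  2<m : 2 < m
  2<m = ≤-trans (s≤s (s≤s (s≤s z≤n))) 4≤m

  mate-in-1 : ∀ {ρ k r b} → 4 ≤ ρ → At k 1 2 → At r 2 ρ → At b 0 0 → WinIn m n 1 (pos k (just r) b)
  mate-in-1 {ρ} {k} {r} {b} 4≤ρ K R B = pos k (just s) b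
    , rookMove (on S) (at-≢ R S (inj₂ ρ≢0) , inj₁ (X-injective (on R) (on S) (trans (Xs R) (sym (Xs S)))))
        (λ { (inj₁ (_ , c , _)) → col-≢ K R (λ ()) c ; (inj₂ (c , _)) → row-≢ R S ρ≢0 c })
        (λ { (inj₁ (_ , c , _)) → col-≢ B R (λ ()) c ; (inj₂ (c , _)) → row-≢ R S ρ≢0 c })
        (at-≢ S K (inj₁ λ ())) (at-≢ S B (inj₁ λ ()))
    , inj₁ (row-attack {b = b} K S B (λ ()) (λ ()) , λ q → black-moves (λ _ → ⊥) K S B (proj₁ (far-apart ≤-refl) ∘ proj₁) go)
    where
    ρ≢0 : ρ ≢ 0
    ρ≢0 = >⇒≢ (≤-trans (s≤s z≤n) 4≤ρ)
    s : Sq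
    s = place 2 0
    S : At s 2 0
    S = at-place 2<m (≤-trans (s≤s z≤n) 5≤n)
    go : ∀ t {u v} → At t u v → Close 0 u → Close 0 v → b ≢ t → ¬ (Close u 1 × Close v 2) → ¬ RookAttacks (pos k (just s) b) t → ⊥
    go t U cu cv b≢t ¬near ¬att with closeView cu | closeView cv
    ... | level | level = contradiction (at-≡ B U) b≢t
    ... | above | level = contradiction (row-attack {b = b} K S U (λ ()) (λ ())) ¬att
    ... | level | above = contradiction (close-suc , close-suc) ¬near
    ... | above | above = contradiction (close-refl , close-suc) ¬near

  -- A quiet rook move to column 2 puts Black in zugzwang: the king on `(1 , 2)` guards row 1, and
  -- only the corner is left.
  mate-in-2 : ∀ {ρ k r b} → 4 ≤ ρ → At k 1 2 → At r 1 ρ → At b 1 0 → WinIn m n 2 (pos k (just r) b)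
  mate-in-2 {ρ} {k} {r} {b} 4≤ρ K R B = pos k (just s) b
    , rookMove (on S) (at-≢ R S (inj₁ λ ()) , inj₂ (Y-injective (on R) (on S) (trans (Ys R) (sym (Ys S)))))
        (λ { (inj₁ (c , _)) → col-≢ R S (λ ()) c ; (inj₂ (_ , c , _)) → row-≢ K R 2≢ρ c })
        (λ { (inj₁ (c , _)) → col-≢ R S (λ ()) c ; (inj₂ (_ , c , _)) → row-≢ B R 0≢ρ c })
        (at-≢ S K (inj₁ λ ())) (at-≢ S B (inj₁ λ ()))
    , inj₂ ((_ , corner) , λ q → black-moves (WinIn m n 1) K S B (proj₁ (far-apart (≤-trans (s≤s (s≤s z≤n)) 4≤ρ)) ∘ proj₂) go)
    where
    0≢ρ : 0 ≢ ρ
    0≢ρ = <⇒≢ (≤-trans (s≤s z≤n) 4≤ρ)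
    2≢ρ : 2 ≢ ρ
    2≢ρ = <⇒≢ (≤-trans (s≤s (s≤s (s≤s z≤n))) 4≤ρ)
    s : Sq
    s = place 2 (Y r)
    S : At s 2 ρ
    S = at (place-on 2<m (Y< (on R))) (X-place 2<m) (trans (Y-place (Y< (on R))) (Ys R))
    C : At (place 0 0) 0 0
    C = at-place 0<m (≤-trans (s≤s z≤n) 5≤n)
    corner : BMove m n (pos k (just s) b) (pos k (just s) (place 0 0))
    corner = black-step B C K (close-sym close-suc) close-refl (at-≢ B C (inj₁ λ ())) (proj₁ (far-apart ≤-refl) ∘ proj₂)
      (no-attack {k = k} {b = b} S C (λ ()) (0≢ρ ∘ sym)) (at-≢ S C (inj₁ λ ()))
    go : ∀ t {u v} → At t u v → Close 1 u → Close 0 v → b ≢ t → ¬ (Close u 1 × Close v 2) →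
      ¬ RookAttacks (pos k (just s) b) t → WinIn m n 1 (pos k (just s) t)
    go t U cu cv b≢t ¬near ¬att with closeView cu | closeView cv
    ... | _     | above = contradiction (close-sym cu , close-suc) ¬near
    ... | below | level = mate-in-1 4≤ρ K S U
    ... | level | level = contradiction (at-≡ B U) b≢t
    ... | above | level = contradiction (column-attack {b = b} K S U (λ ()) (0≢ρ ∘ sym)) ¬att

  -- A straight step to `(0 , 2)` would be stalemate. The diagonal step to `(1 , 2)` blocks the
  -- column of White's own rook, so that Black has exactly one move, to `(1 , 0)`.
  mate-in-3 : ∀ {ρ k r b} → 4 ≤ ρ → At k 0 3 → At r 1 ρ → At b 0 0 → WinIn m n 3 (pos k (just r) b)
  mate-in-3 {ρ} {k} {r} {b} 4≤ρ K R B = pos s (just r) b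
    , king-step K S B close-suc (close-sym close-suc) (at-≢ K S (inj₁ λ ())) (proj₂ (far-apart ≤-refl) ∘ proj₂) (at-≢ R S (inj₂ (2≢ρ ∘ sym)))
    , inj₂ ((_ , sidestep) , λ q → black-moves (WinIn m n 2) S R B (proj₁ (far-apart (≤-trans (s≤s (s≤s z≤n)) 4≤ρ)) ∘ proj₂) go)
    where
    2<n : 2 < n
    2<n = ≤-trans (s≤s (s≤s (s≤s z≤n))) 5≤n
    0≢ρ : 0 ≢ ρ
    0≢ρ = <⇒≢ (≤-trans (s≤s z≤n) 4≤ρ)
    2≢ρ : 2 ≢ ρ
    2≢ρ = <⇒≢ (≤-trans (s≤s (s≤s (s≤s z≤n))) 4≤ρ)
    s : Sq
    s = place 1 2
    S : At s 1 2
    S = at-place 1<m 2<n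
    C : At (place 1 0) 1 0
    C = at-place 1<m (≤-trans (s≤s z≤n) 5≤n)
    nearer : ∀ {a c y y′} → On a → On c → y < y′ → Y a ≡ y → Y c ≡ y′ → row c < row a
    nearer oa oc y<y′ refl refl = ∸-reflects-< n y<y′
    shielded-corner : ¬ RookAttacks (pos s (just r) b) (place 1 0)
    shielded-corner (_ , refl , (_ , inj₁ c) , open-line) = open-line (inj₁ (c , X-injective (on S) (on R) (trans (Xs S) (sym (Xs R))) ,
      inj₁ (nearer (on S) (on R) (≤-trans (s≤s (s≤s (s≤s z≤n))) 4≤ρ) (Ys S) (Ys R) , nearer (on C) (on S) (s≤s z≤n) (Ys C) (Ys S))))
    shielded-corner (_ , refl , (_ , inj₂ c) , _) = row-≢ R C (0≢ρ ∘ sym) c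
    sidestep : BMove m n (pos s (just r) b) (pos s (just r) (place 1 0))
    sidestep = black-step B C S close-suc close-refl (at-≢ B C (inj₁ λ ())) (proj₁ (far-apart ≤-refl) ∘ proj₂)
      shielded-corner (at-≢ R C (inj₂ (0≢ρ ∘ sym)))
    go : ∀ t {u v} → At t u v → Close 0 u → Close 0 v → b ≢ t → ¬ (Close u 1 × Close v 2) →
      ¬ RookAttacks (pos s (just r) b) t → WinIn m n 2 (pos s (just r) t)
    go t U cu cv b≢t ¬near ¬att with closeView cu | closeView cv
    ... | level | level = contradiction (at-≡ B U) b≢t
    ... | above | level = mate-in-2 4≤ρ S R U
    ... | level | above = contradiction (close-suc , close-suc) ¬near
    ... | above | above = contradiction (close-refl , close-suc) ¬near

  -- A black king on the edge column, cut off by the rook next to it, can only step along that column.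
  confined : ∀ {l t ρ y k r b} → At k 0 t → At r 1 ρ → At b 0 y → suc y < ρ →
    (∀ s z → At s 0 z → CloseView y z → y ≢ z → ¬ Close z t → WinIn m n l (pos k (just r) s)) →
    ∀ q → BMove m n (pos k (just r) b) q → WinIn m n l q
  confined {l} {t} {ρ} {y} {k} {r} {b} K R B y<ρ win q = black-moves (WinIn m n l) K R B (proj₁ (far-apart y<ρ) ∘ proj₂) go
    where
    go : ∀ s {u v} → At s u v → Close 0 u → Close y v → b ≢ s → ¬ (Close u 0 × Close v t) →
      ¬ RookAttacks (pos k (just r) b) s → WinIn m n l (pos k (just r) s)
    go s {v = v} U cu cv b≢s ¬near ¬att with closeView cu
    ... | level = win s v U (closeView cv) (λ { refl → b≢s (at-≡ B U) }) (λ c → ¬near (close-refl , c))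
    ... | above = contradiction (column-attack {b = b} K R U (λ ()) (>⇒≢ (≤-trans (s≤s (proj₂ cv)) y<ρ))) ¬att

  step-along : ∀ {t ρ y z k r b} → At k 0 t → At r 1 ρ → At b 0 y → (z<n : z < n) → Close y z → y ≢ z → ¬ Close z t → z ≢ ρ →
    BMove m n (pos k (just r) b) (pos k (just r) (place 0 z))
  step-along {z = z} {k} {b = b} K R B z<n c y≢z ¬near z≢ρ = black-step B Z K close-refl c (at-≢ B Z (inj₂ y≢z)) (¬near ∘ proj₂)
    (no-attack {k = k} {b = b} R Z (λ ()) (z≢ρ ∘ sym)) (at-≢ R Z (inj₁ λ ()))
    where
    Z : At (place 0 z) 0 z
    Z = at-place 0<m z<n

  -- The distance t ∸ y between the kings is odd, so White can always keep the opposition.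
  march : ∀ t j y {ρ k r b} → t ≡ 3 + y + (j + j) → t ≤ suc ρ → 4 ≤ ρ →
    At k 0 t → At r 1 ρ → At b 0 y → WinIn m n t (pos k (just r) b)
  advance : ∀ t j y {ρ k r b} → 0 < y + j → suc t ≡ 3 + y + (j + j) → suc t ≤ suc ρ → 4 ≤ ρ → At k 0 (suc t) → At r 1 ρ → At b 0 y →
    WinIn m n (suc t) (pos k (just r) b)

  march t zero zero refl _ 4≤ρ K R B = mate-in-3 4≤ρ K R B
  march (suc t) zero    (suc y) eq = advance t zero (suc y) (s≤s z≤n) eq
  march (suc t) (suc j) y       eq = advance t (suc j) y (≤-trans (s≤s z≤n) (m≤n+m (suc j) y)) eq

  advance t j y {ρ} {k} {r} {b} 0<y+j eq t≤ρ 4≤ρ K R B = pos s (just r) b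
    , king-step K S B close-refl (close-sym close-suc) (at-≢ K S (inj₂ 1+n≢n)) (proj₂ (far-apart 2+y≤t) ∘ proj₂) (at-≢ R S (inj₁ λ ()))
    , inj₂ (moves j y 0<y+j t≡ 2+y≤t B , confined S R B (≤-trans 2+y≤t (≤-pred t≤ρ)) (win j y t≡))
    where
    t≡ : t ≡ 2 + y + (j + j)
    t≡ = suc-injective eq
    2+y≤t : 2 + y ≤ t
    2+y≤t = ≤-trans (m≤m+n (2 + y) (j + j)) (≤-reflexive (sym t≡))
    t<n : t < n
    t<n = ≤-trans (n≤1+n _) (subst (_< n) (Ys K) (Y< (on K)))
    s : Sq
    s = place 0 t
    S : At s 0 t
    S = at-place 0<m t<n
    moves : ∀ j y → 0 < y + j → t ≡ 2 + y + (j + j) → 2 + y ≤ t → At b 0 y → ∃ λ q → BMove m n (pos s (just r) b) q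
    moves j (suc y) _ t≡ y+3≤t B = _ , step-along S R B (≤-trans (≤-trans (n≤1+n _) (≤-trans (n≤1+n _) y+3≤t)) (<⇒≤ t<n))
      (close-sym close-suc) 1+n≢n (proj₁ (far-apart (≤-trans (n≤1+n _) y+3≤t)))
      (<⇒≢ (≤-trans (≤-trans (n≤1+n _) (≤-trans (n≤1+n _) y+3≤t)) (≤-pred t≤ρ)))
    -- Here Black would be stalemated in the corner; `0 < y + j` leaves this case to `mate-in-3`.
    moves zero    zero ()
    moves (suc j) zero _ t≡ _ B = _ , step-along S R B (≤-trans (s≤s (s≤s z≤n)) 5≤n) close-suc (λ ())
      (proj₁ (far-apart (≤-trans (s≤s (s≤s (s≤s z≤n))) (≤-reflexive (sym (trans t≡ (cong (3 +_) (+-suc j j))))))))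
      (<⇒≢ (≤-trans (s≤s (s≤s z≤n)) 4≤ρ))
    win : ∀ j y → t ≡ 2 + y + (j + j) → ∀ u z → At u 0 z → CloseView y z → y ≢ z → ¬ Close z t → WinIn m n t (pos s (just r) u)
    win j y       t≡ u z U level y≢z _    = contradiction refl y≢z
    win j (suc y) t≡ u z U below _ _      = march t j y t≡ (≤-trans (≤-pred t≤ρ) (n≤1+n ρ)) 4≤ρ S R U
    win zero y    t≡ u z U above _ ¬near  = contradiction (subst (Close (suc y)) (sym (trans t≡ (+-identityʳ _))) close-suc) ¬near
    win (suc j) y t≡ u z U above _ _      = march t j (suc y)
      (trans t≡ (cong (2 +_) (trans (cong (y +_) (cong suc (+-suc j j))) (trans (+-suc y _) (cong suc (+-suc y _))))))
      (≤-trans (≤-pred t≤ρ) (n≤1+n ρ)) 4≤ρ S R U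

  k₀ r₀ b₀ : Sq
  k₀ = m , 1
  r₀ = 1 , 1
  b₀ = m , n

  0<n : 0 < n
  0<n = ≤-trans (s≤s z≤n) 5≤n

  n∸1<n : n ∸ 1 < n
  n∸1<n = ∸-monoʳ-< {n} (s≤s z≤n) 0<n

  4≤n∸1 : 4 ≤ n ∸ 1
  4≤n∸1 = ∸-monoˡ-≤ 1 5≤n

  -- Once the rook guards column 1, the black king in the corner has the single move to `(0 , 1)`,
  -- so White only has to win from there.
  cut-off : ∀ {l} → (∀ {k r b} → At k 0 (n ∸ 1) → At r 1 (n ∸ 1) → At b 0 1 → WinIn m n l (pos k (just r) b)) →
    WinIn m n (suc l) (start m n)
  cut-off {l} win = pos k₀ (just s) b₀
    , rookMove (on S) (at-≢ R S (inj₁ m∸1≢1) , inj₂ (Y-injective (on R) (on S) (trans (Ys R) (sym (Ys S)))))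
        (λ { (inj₁ (c , _)) → col-≢ R S m∸1≢1 c
           ; (inj₂ (_ , _ , inj₁ (_ , m<))) → <⇒≱ m< (m∸n≤m m 1)
           ; (inj₂ (_ , _ , inj₂ (_ , m<1))) → <⇒≱ m<1 0<m })
        (λ { (inj₁ (c , _)) → col-≢ R S m∸1≢1 c ; (inj₂ (_ , c , _)) → row-≢ B R (<⇒≢ (≤-trans (s≤s z≤n) 4≤n∸1)) c })
        (at-≢ S K (inj₁ λ ())) (at-≢ S B (inj₁ λ ()))
    , inj₂ ((_ , step-along K S B (≤-trans (s≤s (s≤s z≤n)) 5≤n) close-suc (λ ()) (proj₁ (far-apart (≤-trans (s≤s (s≤s (s≤s z≤n))) 4≤n∸1)))
              (<⇒≢ (≤-trans (s≤s (s≤s z≤n)) 4≤n∸1)))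
           , confined K S B (≤-trans (s≤s (s≤s z≤n)) 4≤n∸1) reply-win)
    where
    K : At k₀ 0 (n ∸ 1)
    K = at ((0<m , ≤-refl) , s≤s z≤n , 0<n) (n∸n≡0 m) refl
    R : At r₀ (m ∸ 1) (n ∸ 1)
    R = at ((s≤s z≤n , 0<m) , s≤s z≤n , 0<n) refl refl
    B : At b₀ 0 0
    B = at ((0<m , ≤-refl) , 0<n , ≤-refl) (n∸n≡0 m) (n∸n≡0 n)
    s : Sq
    s = place 1 (n ∸ 1)
    S : At s 1 (n ∸ 1)
    S = at-place 1<m n∸1<n
    m∸1≢1 : m ∸ 1 ≢ 1
    m∸1≢1 = >⇒≢ (≤-trans (s≤s (s≤s z≤n)) (∸-monoˡ-≤ 1 4≤m))
    reply-win : ∀ u z → At u 0 z → CloseView 0 z → 0 ≢ z → ¬ Close z (n ∸ 1) → WinIn m n l (pos k₀ (just s) u)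
    reply-win u z U level 0≢z _ = contradiction refl 0≢z
    reply-win u z U above _   _ = win K S U

  -- The distance between the kings is even here. Passing with the rook along its column keeps Black
  -- confined, and either black step makes the distance odd, as `march` requires.
  wait : ∀ {j k r b} → n ∸ 1 ≡ 5 + (j + j) → At k 0 (n ∸ 1) → At r 1 (n ∸ 1) → At b 0 1 →
    WinIn m n (suc (n ∸ 1)) (pos k (just r) b)
  wait {j} {k} {r} {b} eq K R B = pos k (just s) b
    , rookMove (on S) (at-≢ R S (inj₂ lower) , inj₁ (X-injective (on R) (on S) (trans (Xs R) (sym (Xs S)))))
        (λ { (inj₁ (_ , c , _)) → col-≢ K R (λ ()) c ; (inj₂ (c , _)) → row-≢ R S lower c })
        (λ { (inj₁ (_ , c , _)) → col-≢ B R (λ ()) c ; (inj₂ (c , _)) → row-≢ R S lower c })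
        (at-≢ S K (inj₁ λ ())) (at-≢ S B (inj₁ λ ()))
    , inj₂ ((_ , step-along K S B 0<n (close-sym close-suc) (λ ()) (proj₁ (far-apart (≤-trans (s≤s (s≤s z≤n)) 4≤n∸1))) λ ())
           , confined K S B (s≤s (s≤s (s≤s z≤n))) reply-win)
    where
    ρ : ℕ
    -- This is row `n ∸ 2`, one row nearer the top than the white king: the reason why `march`
    -- allows `t ≤ suc ρ`.
    ρ = 4 + (j + j)
    lower : n ∸ 1 ≢ ρ
    lower eq′ = 1+n≢n (trans (sym eq) eq′)
    s : Sq
    s = place 1 ρ
    S : At s 1 ρ
    S = at-place 1<m (<-trans (≤-reflexive (sym eq)) n∸1<n)
    reply-win : ∀ u z → At u 0 z → CloseView 1 z → 1 ≢ z → ¬ Close z (n ∸ 1) → WinIn m n (n ∸ 1) (pos k (just s) u)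
    reply-win u z U level 1≢z _ = contradiction refl 1≢z
    reply-win u z U below _   _ = march (n ∸ 1) (suc j) 0 (trans eq (cong (4 +_) (sym (+-suc j j)))) (≤-reflexive eq) (m≤m+n 4 (j + j)) K S U
    reply-win u z U above _   _ = march (n ∸ 1) j 2 eq (≤-reflexive eq) (m≤m+n 4 (j + j)) K S U

mainTheorem1 : (m n : ℕ) → 4 ≤ m → 5 ≤ n →
    (n % 2 ≡ 1 → IsFM m n n) × (n % 2 ≡ 0 → IsFM m n (suc n))
mainTheorem1 (suc m) (suc n) 4≤m 5≤n =
  (λ odd → odd-win odd , minimal (odd-bound odd)) , (λ even → even-win even , minimal (even-bound even))
  where
  open LowerBound m n 4≤m 5≤n
  open UpperBound (suc m) (suc n) 4≤m 5≤n
  minimal : ∀ {l} → ¬ WinIn (suc m) (suc n) l (start (suc m) (suc n)) →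
    ∀ k → WinIn (suc m) (suc n) k (start (suc m) (suc n)) → suc l ≤ k
  minimal lost k win = ≰⇒> λ k≤l → lost (WinIn-mono k≤l win)
  odd-win : suc n % 2 ≡ 1 → WinIn (suc m) (suc n) (suc n) (start (suc m) (suc n))
  -- On `suc n` rows the white king is on row `n` and, after the cut-off, the black king on row 1:
  -- `march` needs `n ≡ 4 + (j + j)`. For even height `wait` needs `n ≡ 5 + (j + j)`.
  odd-win odd with half (n ∸ 4) (parity-pred {n ∸ 4} (trans (cong parity shifted) (trans (parity≡%2 (suc n)) odd)))
    where
    shifted : 5 + (n ∸ 4) ≡ suc n
    shifted = cong suc (m+[n∸m]≡n (≤-pred 5≤n))
  ... | j , eq = cut-off (march n j 1 (trans (sym (m+[n∸m]≡n (≤-pred 5≤n))) (cong (4 +_) eq)) (n≤1+n n) (≤-pred 5≤n))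
  even-win : suc n % 2 ≡ 0 → WinIn (suc m) (suc n) (suc (suc n)) (start (suc m) (suc n))
  even-win even with m≤n⇒m<n∨m≡n 5≤n
  ... | inj₂ refl = contradiction even λ ()
  ... | inj₁ (s≤s 5≤n′) with half (n ∸ 5) (trans (cong parity (cong suc (m+[n∸m]≡n 5≤n′))) (trans (parity≡%2 (suc n)) even))
  ...   | j , eq = cut-off (wait {j} (trans (sym (m+[n∸m]≡n 5≤n′)) (cong (5 +_) eq)))
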